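{- For any set $\Sigma$ of skeletal Sahlqvist formulas of $\mathcal{L}(@,\downarrow)$, the logic $\mathbf{K}_{\mathcal{H}(@,\downarrow)}+\Sigma$ is sound and strongly complete with respect to the class $\mathcal{F}$ of Kripke frames defined by $\Sigma$, i.e. $\mathcal{F}=\{\mathbb{F} : \mathbb{F}\Vdash\sigma\text{ for all }\sigma\in\Sigma\}$. That is, for every set $\Gamma$ of $\mathcal{L}(@,\downarrow)$-formulas and every $\mathcal{L}(@,\downarrow)$-formula $\gamma$: $\Gamma\vdash_{\Sigma}\gamma$ if and only if $\Gamma\Vdash_{\mathcal{F}}\gamma$.
   Context: **Language.** Let $\mathsf{Prop}$ (propositional variables), $\mathsf{Svar}$ (state variables), $\mathsf{Nom}$ (nominals) be pairwise disjoint countably infinite sets. Formulas of $\mathcal{L}(@,\downarrow)$: $\varphi::=p\mid x\mid\mathbf{i}\mid\bot\mid\top\mid\neg\varphi\mid\varphi\lor\varphi\mid\varphi\land\varphi\mid\varphi\to\varphi\mid\Diamond\varphi\mid\Box\varphi\mid @_x\varphi\mid @_{\mathbf{i}}\varphi\mid\downarrow x.\varphi$, with $p\in\mathsf{Prop}$, $x\in\mathsf{Svar}$, $\mathbf{i}\in\mathsf{Nom}$. The binder $\downarrow x$ binds $x$. Terms are nominals and state variables. A substitution $\sigma$ uniformly replaces propositional variables by formulas and terms by terms; it is safe for $\phi$ if it does not make free occurrences of a state variable $x$ be substituted into the scope of $\downarrow x$. **Semantics.** A Kripke frame is $\mathbb{F}=(W,R)$ with $W\ne\emptyset$, $R\subseteq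 W\times W$. A model $\mathbb{M}=(\mathbb{F},V)$ has $V:\mathsf{Prop}\cup\mathsf{Nom}\to P(W)$ with $V(\mathbf{i})$ a singleton for each nominal (identified with its element below). An assignment is $g:\mathsf{Svar}\to W$; $g^x_w$ agrees with $g$ except that $g^x_w(x)=w$. Satisfaction $\mathbb{M},g,w\Vdash\varphi$: $p$ iff $w\in V(p)$; $x$ iff $g(x)=w$; $\mathbf{i}$ iff $V(\mathbf{i})=\{w\}$; Boolean connectives as usual; $\Diamond\varphi$ iff some $v$ with $Rwv$ satisfies $\varphi$; $\Box\varphi$ iff all $v$ with $Rwv$ satisfy $\varphi$; $@_x\varphi$ iff $\mathbb{M},g,g(x)\Vdash\varphi$; $@_{\mathbf{i}}\varphi$ iff $\mathbb{M},g,V(\mathbf{i})\Vdash\varphi$; $\downarrow x.\varphi$ iff $\mathbb{M},g^x_w,w\Vdash\varphi$. $\mathbb{F}\Vdash\varphi$ (validity) means $\mathbb{F},V,g,w\Vdash\varphi$ for all $V,g,w$. For a class of frames $\mathcal{F}$, $\Gamma\Vdash_{\mathcal{F}}\varphi$ means: for every $\mathbb{F}\in\mathcal{F}$ and all $V,g,w$, if $\mathbb{F},V,g,w\Vdash\gamma$ for all $\gamma\in\Gamma$ then $\mathbb{F},V,g,w\Vdash\varphi$. **Hilbert system $\mathbf{K}_{\mathcal{H}(@,\downarrow)}$.** Axioms: all classical tautologies; (Dual) $\Diamond p\leftrightarrow\neg\Box\neg p$; (K) $\Box(p\to q)\to(\Box p\to\Box q)$; (K$_@$) $@_{\mathbf{i}}(p\to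 q)\to(@_{\mathbf{i}}p\to @_{\mathbf{i}}q)$; (Selfdual) $\neg@_{\mathbf{i}}p\leftrightarrow @_{\mathbf{i}}\neg p$; (Ref) $@_{\mathbf{i}}\mathbf{i}$; (Intro) $\mathbf{i}\land p\to @_{\mathbf{i}}p$; (Back) $\Diamond @_{\mathbf{i}}p\to @_{\mathbf{i}}p$; (Agree) $@_{\mathbf{i}}@_{\mathbf{j}}p\to @_{\mathbf{j}}p$; (DA) $@_{\mathbf{i}}(\downarrow x.\phi\leftrightarrow\phi[\mathbf{i}/x])$, where $\phi[\mathbf{i}/x]$ replaces the free occurrences of $x$ in $\phi$ by $\mathbf{i}$; (Name$_\downarrow$) $\downarrow x.@_x\phi\to\phi$ if $x$ does not occur in $\phi$; (BG$_\downarrow$) $@_{\mathbf{i}}\Box\downarrow x.@_{\mathbf{i}}\Diamond x$. Rules: modus ponens; (SB) from $\phi$ infer $\phi^\sigma$ for $\sigma$ safe for $\phi$; from $\phi$ infer $\Box\phi$; from $\phi$ infer $@_{\mathbf{i}}\phi$; from $\phi$ infer $\downarrow x.\phi$. $\mathbf{K}_{\mathcal{H}(@,\downarrow)}+\Sigma$ adds all formulas in $\Sigma$ as axioms, closed under these rules; $\vdash_\Sigma\phi$ means $\phi$ is a theorem of it. $\Gamma\vdash_\Sigma\phi$ means there are $\gamma_1,\dots,\gamma_n\in\Gamma$ with $\vdash_\Sigma\gamma_1\land\dots\land\gamma_n\to\phi$. Sound with respect to $\mathcal{F}$: $\Gamma\vdash_\Sigma\phi$ implies $\Gamma\Vdash_{\mathcal{F}}\phi$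 for all $\Gamma,\phi$; strongly complete: the converse implication for all $\Gamma,\phi$. **Skeletal Sahlqvist formulas.** An order-type of propositional variables $(p_1,\dots,p_n)$ is $\epsilon\in\{1,\partial\}^n$. The positive (negative) signed generation tree $+\phi$ ($-\phi$) is the generation (syntax) tree of $\phi$ with root signed $+$ ($-$), signs propagated downwards: $\lor,\land,\Box,\Diamond,\downarrow x$ give their children the same sign; $\neg$ the opposite sign; $\to$ the opposite sign to its first child and the same sign to its second; $@$ the same sign to its second (formula) child, the nominal or state variable index not being labelled. A leaf $+p_i$ with $\epsilon_i=1$ or $-p_i$ with $\epsilon_i=\partial$ is an $\epsilon$-critical node; an $\epsilon$-critical branch is a branch from such a leaf to the root. Skeletal nodes are: $+\lor,+\land,+\Diamond,+\neg,+\downarrow x,+@$ and $-\land,-\lor,-\Box,-\neg,-\downarrow x,-@,-\to$. A branch is skeletal if, apart from variable nodes, it consists of skeletal nodes only. A signed tree is $\epsilon$-skeletal Sahlqvist if every $\epsilon$-critical branch is skeletal. The formula $\phi\to\psi$ (with propositional variables among $p_1,\dots,p_n$) is skeletal Sahlqvist if for some order-type $\epsilon$ (which may depend on the formula) both $+\phi$ and $-\psi$ are $\epsilon$-skeletal Sahlqvist. -}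

module Defs where

open import Data.Bool.Base using (Bool; true; false; if_then_else_; not; _∧_; _∨_)
open import Data.Empty using (⊥)
open import Data.Fin.Base using (Fin)
open import Data.List.Base using (List; []; _∷_; foldr)
import Data.List.Membership.Propositional as ListMembership
open import Data.List.Relation.Unary.All using (All)
open import Data.Nat.Base using (ℕ)
open import Data.Nat.Properties using (_≟_)
open import Data.Product.Base using (_×_; ∃-syntax)
open import Data.Sign.Base using (Sign; +; -; opposite)
open import Data.Sum.Base using (_⊎_)
open import Data.Unit.Base using (⊤)
open import Function.Definitions using (Injective)
open import Level using (0ℓ; suc)
open import Relation.Binary.PropositionalEquality.Core using (_≡_; _≢_)
open import Relation.Nullary.Decidable.Core using (does)
open import Relation.Nullary.Negation.Core using (¬_)
open import Relation.Unary using (Pred; _∈_)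

-- Three countably infinite sets of symbols, each indexed by ℕ. They are
-- pairwise disjoint as atoms because distinct constructors inject them
-- into terms and formulas.
PropVar Svar Nom : Set
PropVar = ℕ
Svar    = ℕ
Nom     = ℕ

data Term : Set where
  sv : Svar → Term
  nm : Nom → Term

infix  40 _[_/_]
infix  30 ¬′_ ◇_ □_
infixr 25 _∧′_
infixr 24 _∨′_
infixr 23 _⇒_
infix  22 _⇔′_

data Form : Set where
  var            : PropVar → Form
  tm             : Term → Form
  ⊥′ ⊤′          : Form
  ¬′_            : Form → Form
  _∨′_ _∧′_ _⇒_  : Form → Form → Form
  ◇_ □_          : Form → Form
  at             : Term → Form → Form
  ↓              : Svar → Form → Form

_⇔′_ : Form → Form → Form
φ ⇔′ ψ = (φ ⇒ ψ) ∧′ (ψ ⇒ φ)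

⋀ : List Form → Form
⋀ = foldr _∧′_ ⊤′

FreeInTerm : Svar → Term → Set
FreeInTerm x t = t ≡ sv x

FreeIn : Svar → Form → Set
FreeIn x (var p)  = ⊥
FreeIn x (tm t)   = FreeInTerm x t
FreeIn x ⊥′       = ⊥
FreeIn x ⊤′       = ⊥
FreeIn x (¬′ φ)   = FreeIn x φ
FreeIn x (φ ∨′ ψ) = FreeIn x φ ⊎ FreeIn x ψ
FreeIn x (φ ∧′ ψ) = FreeIn x φ ⊎ FreeIn x ψ
FreeIn x (φ ⇒ ψ)  = FreeIn x φ ⊎ FreeIn x ψ
FreeIn x (◇ φ)    = FreeIn x φ
FreeIn x (□ φ)    = FreeIn x φ
FreeIn x (at t φ) = FreeInTerm x t ⊎ FreeIn x φ
FreeIn x (↓ y φ)  = x ≢ y × FreeIn x φ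

-- Any occurrence counts: free, bound, or next to a binder.
OccursIn : Svar → Form → Set
OccursIn x (var p)  = ⊥
OccursIn x (tm t)   = t ≡ sv x
OccursIn x ⊥′       = ⊥
OccursIn x ⊤′       = ⊥
OccursIn x (¬′ φ)   = OccursIn x φ
OccursIn x (φ ∨′ ψ) = OccursIn x φ ⊎ OccursIn x ψ
OccursIn x (φ ∧′ ψ) = OccursIn x φ ⊎ OccursIn x ψ
OccursIn x (φ ⇒ ψ)  = OccursIn x φ ⊎ OccursIn x ψ
OccursIn x (◇ φ)    = OccursIn x φ
OccursIn x (□ φ)    = OccursIn x φ
OccursIn x (at t φ) = t ≡ sv x ⊎ OccursIn x φ
OccursIn x (↓ y φ)  = x ≡ y ⊎ OccursIn x φ

record Subst : Set where
  field
    onProp : PropVar → Form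
    onSvar : Svar → Term
    onNom  : Nom → Term
open Subst public

_[_↦_] : Subst → Svar → Term → Subst
σ [ x ↦ t ] = record
  { onProp = onProp σ
  ; onSvar = λ y → if does (y ≟ x) then t else onSvar σ y
  ; onNom  = onNom σ
  }

idSubst : Subst
idSubst = record { onProp = var ; onSvar = sv ; onNom = nm }

substTerm : Subst → Term → Term
substTerm σ (sv x) = onSvar σ x
substTerm σ (nm i) = onNom σ i

-- Only free occurrences of state variables are replaced; there is no
-- renaming of bound variables, so capture is possible and is excluded
-- by Safe below.
subst : Subst → Form → Form
subst σ (var p)  = onProp σ p
subst σ (tm t)   = tm (substTerm σ t)
subst σ ⊥′       = ⊥′
subst σ ⊤′       = ⊤′
subst σ (¬′ φ)   = ¬′ subst σ φ
subst σ (φ ∨′ ψ) = subst σ φ ∨′ subst σ ψ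
subst σ (φ ∧′ ψ) = subst σ φ ∧′ subst σ ψ
subst σ (φ ⇒ ψ)  = subst σ φ ⇒ subst σ ψ
subst σ (◇ φ)    = ◇ subst σ φ
subst σ (□ φ)    = □ subst σ φ
subst σ (at t φ) = at (substTerm σ t) (subst σ φ)
subst σ (↓ y φ)  = ↓ y (subst (σ [ y ↦ sv y ]) φ)

_[_/_] : Form → Nom → Svar → Form
φ [ i / x ] = subst (idSubst [ x ↦ nm i ]) φ

-- SafeUnder B σ φ: with B the variables bound by the ↓'s enclosing φ,
-- no atom of φ (other than the variables bound there) is replaced by
-- something in which a variable bound at that place is free.
SafeTermUnder : List Svar → Subst → Term → Set
SafeTermUnder B σ (sv x) =
  x ListMembership.∈ B ⊎ All (λ y → ¬ FreeInTerm y (onSvar σ x)) B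
SafeTermUnder B σ (nm i) = All (λ y → ¬ FreeInTerm y (onNom σ i)) B

SafeUnder : List Svar → Subst → Form → Set
SafeUnder B σ (var p)  = All (λ y → ¬ FreeIn y (onProp σ p)) B
SafeUnder B σ (tm t)   = SafeTermUnder B σ t
SafeUnder B σ ⊥′       = ⊤
SafeUnder B σ ⊤′       = ⊤
SafeUnder B σ (¬′ φ)   = SafeUnder B σ φ
SafeUnder B σ (φ ∨′ ψ) = SafeUnder B σ φ × SafeUnder B σ ψ
SafeUnder B σ (φ ∧′ ψ) = SafeUnder B σ φ × SafeUnder B σ ψ
SafeUnder B σ (φ ⇒ ψ)  = SafeUnder B σ φ × SafeUnder B σ ψ
SafeUnder B σ (◇ φ)    = SafeUnder B σ φ
SafeUnder B σ (□ φ)    = SafeUnder B σ φ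
SafeUnder B σ (at t φ) = SafeTermUnder B σ t × SafeUnder B σ φ
SafeUnder B σ (↓ y φ)  = SafeUnder (y ∷ B) σ φ

Safe : Subst → Form → Set
Safe = SafeUnder []

-- Kripke semantics

-- A point of W witnesses W ≠ ∅; nothing depends on which one.
record Frame : Set₁ where
  field
    W        : Set
    R        : W → W → Set
    nonempty : W
open Frame public

-- The singleton V(i) is represented by its element.
record Valuation (F : Frame) : Set₁ where
  field
    Vprop : PropVar → Pred (W F) 0ℓ
    Vnom  : Nom → W F
open Valuation public

Assignment : Frame → Set
Assignment F = Svar → W F

_⟨_≔_⟩ : {A : Set} → (Svar → A) → Svar → A → (Svar → A)
(g ⟨ x ≔ w ⟩) y = if does (y ≟ x) then w else g y

⟦_⟧ : Term → {F : Frame} → Valuation F → Assignment F → W F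
⟦ sv x ⟧ V g = g x
⟦ nm i ⟧ V g = Vnom V i

Sat : (F : Frame) → Valuation F → Assignment F → W F → Form → Set
Sat F V g w (var p)  = w ∈ Vprop V p
Sat F V g w (tm t)   = ⟦ t ⟧ V g ≡ w
Sat F V g w ⊥′       = ⊥
Sat F V g w ⊤′       = ⊤
Sat F V g w (¬′ φ)   = ¬ Sat F V g w φ
Sat F V g w (φ ∨′ ψ) = Sat F V g w φ ⊎ Sat F V g w ψ
Sat F V g w (φ ∧′ ψ) = Sat F V g w φ × Sat F V g w ψ
Sat F V g w (φ ⇒ ψ)  = Sat F V g w φ → Sat F V g w ψ
Sat F V g w (◇ φ)    = ∃[ v ] R F w v × Sat F V g v φ
Sat F V g w (□ φ)    = ∀ v → R F w v → Sat F V g v φ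
Sat F V g w (at t φ) = Sat F V g (⟦ t ⟧ V g) φ
Sat F V g w (↓ x φ)  = Sat F V (g ⟨ x ≔ w ⟩) w φ

_⊩_ : Frame → Form → Set₁
F ⊩ φ = ∀ V g w → Sat F V g w φ

_⊩[_]_ : Pred Form 0ℓ → Pred Frame (suc 0ℓ) → Form → Set₁
Γ ⊩[ 𝓕 ] φ = ∀ {F} → F ∈ 𝓕 → ∀ V g w →
  (∀ {γ} → γ ∈ Γ → Sat F V g w γ) → Sat F V g w φ

FramesDefinedBy : Pred Form 0ℓ → Pred Frame (suc 0ℓ)
FramesDefinedBy Σ F = ∀ {σ} → σ ∈ Σ → F ⊩ σ

-- The Hilbert system

-- Truth-functional evaluation: v is consulted only at formulas whose
-- main symbol is not Boolean.
eval : (Form → Bool) → Form → Bool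
eval v ⊥′       = false
eval v ⊤′       = true
eval v (¬′ φ)   = not (eval v φ)
eval v (φ ∨′ ψ) = eval v φ ∨ eval v ψ
eval v (φ ∧′ ψ) = eval v φ ∧ eval v ψ
eval v (φ ⇒ ψ)  = not (eval v φ) ∨ eval v ψ
eval v φ        = v φ

Tautology : Form → Set
Tautology φ = ∀ v → eval v φ ≡ true

data Axiom : Form → Set where
  taut     : ∀ {φ} → Tautology φ → Axiom φ
  dual     : ∀ p → Axiom (◇ var p ⇔′ ¬′ □ ¬′ var p)
  K        : ∀ p q → Axiom (□ (var p ⇒ var q) ⇒ □ var p ⇒ □ var q)
  K-at     : ∀ i p q →
             Axiom (at (nm i) (var p ⇒ var q) ⇒ at (nm i) (var p) ⇒ at (nm i) (var q))
  selfdual : ∀ i p → Axiom (¬′ at (nm i) (var p) ⇔′ at (nm i) (¬′ var p))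
  ref      : ∀ i → Axiom (at (nm i) (tm (nm i)))
  intro    : ∀ i p → Axiom (tm (nm i) ∧′ var p ⇒ at (nm i) (var p))
  back     : ∀ i p → Axiom (◇ at (nm i) (var p) ⇒ at (nm i) (var p))
  agree    : ∀ i j p → Axiom (at (nm i) (at (nm j) (var p)) ⇒ at (nm j) (var p))
  DA       : ∀ i x φ → Axiom (at (nm i) (↓ x φ ⇔′ φ [ i / x ]))
  name-↓   : ∀ x φ → ¬ OccursIn x φ → Axiom (↓ x (at (sv x) φ) ⇒ φ)
  BG-↓     : ∀ i x → Axiom (at (nm i) (□ ↓ x (at (nm i) (◇ tm (sv x)))))

infix 4 _⊢_ _⊢[_]_ _⊩_ _⊩[_]_

-- Σ ⊢ φ: φ is a theorem of the system extended with the axioms Σ.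
data _⊢_ (Σ : Pred Form 0ℓ) : Form → Set where
  ax    : ∀ {φ} → Axiom φ → Σ ⊢ φ
  extra : ∀ {φ} → φ ∈ Σ → Σ ⊢ φ
  MP    : ∀ {φ ψ} → Σ ⊢ φ ⇒ ψ → Σ ⊢ φ → Σ ⊢ ψ
  SB    : ∀ {φ} σ → Safe σ φ → Σ ⊢ φ → Σ ⊢ subst σ φ
  Nec-□ : ∀ {φ} → Σ ⊢ φ → Σ ⊢ □ φ
  Nec-at : ∀ {φ} i → Σ ⊢ φ → Σ ⊢ at (nm i) φ
  Nec-↓ : ∀ {φ} x → Σ ⊢ φ → Σ ⊢ ↓ x φ

_⊢[_]_ : Pred Form 0ℓ → Pred Form 0ℓ → Form → Set
Γ ⊢[ Σ ] φ = ∃[ γs ] All (_∈ Γ) γs × Σ ⊢ ⋀ γs ⇒ φ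

-- Skeletal Sahlqvist formulas

record Node : Set where
  constructor _∙_
  field
    sign : Sign
    form : Form
open Node public

infix 20 _∙_
infix 4 _◁_

-- c ◁ n: c is a child of n in a signed generation tree.
data _◁_ : Node → Node → Set where
  ¬-child  : ∀ {s φ}   → opposite s ∙ φ ◁ s ∙ ¬′ φ
  ∨-left   : ∀ {s φ ψ} → s ∙ φ ◁ s ∙ (φ ∨′ ψ)
  ∨-right  : ∀ {s φ ψ} → s ∙ ψ ◁ s ∙ (φ ∨′ ψ)
  ∧-left   : ∀ {s φ ψ} → s ∙ φ ◁ s ∙ (φ ∧′ ψ)
  ∧-right  : ∀ {s φ ψ} → s ∙ ψ ◁ s ∙ (φ ∧′ ψ)
  ⇒-left   : ∀ {s φ ψ} → opposite s ∙ φ ◁ s ∙ (φ ⇒ ψ)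
  ⇒-right  : ∀ {s φ ψ} → s ∙ ψ ◁ s ∙ (φ ⇒ ψ)
  ◇-child  : ∀ {s φ}   → s ∙ φ ◁ s ∙ (◇ φ)
  □-child  : ∀ {s φ}   → s ∙ φ ◁ s ∙ (□ φ)
  at-child : ∀ {s t φ} → s ∙ φ ◁ s ∙ at t φ
  ↓-child  : ∀ {s x φ} → s ∙ φ ◁ s ∙ ↓ x φ

-- Branches from a node down to a leaf labelled by a signed
-- propositional variable.
data Branch : Node → Sign → PropVar → Set where
  leaf : ∀ {s q} → Branch (s ∙ var q) s q
  _∷⟨_⟩_ : ∀ n {c s q} → c ◁ n → Branch c s q → Branch n s q

data SkeletalNode : Node → Set where
  +∨ : ∀ {φ ψ} → SkeletalNode (+ ∙ (φ ∨′ ψ))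
  +∧ : ∀ {φ ψ} → SkeletalNode (+ ∙ (φ ∧′ ψ))
  +◇ : ∀ {φ}   → SkeletalNode (+ ∙ (◇ φ))
  +¬ : ∀ {φ}   → SkeletalNode (+ ∙ (¬′ φ))
  +↓ : ∀ {x φ} → SkeletalNode (+ ∙ ↓ x φ)
  +at : ∀ {t φ} → SkeletalNode (+ ∙ at t φ)
  -∧ : ∀ {φ ψ} → SkeletalNode (- ∙ (φ ∧′ ψ))
  -∨ : ∀ {φ ψ} → SkeletalNode (- ∙ (φ ∨′ ψ))
  -□ : ∀ {φ}   → SkeletalNode (- ∙ (□ φ))
  -¬ : ∀ {φ}   → SkeletalNode (- ∙ (¬′ φ))
  -↓ : ∀ {x φ} → SkeletalNode (- ∙ ↓ x φ)
  -at : ∀ {t φ} → SkeletalNode (- ∙ at t φ)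
  -⇒ : ∀ {φ ψ} → SkeletalNode (- ∙ (φ ⇒ ψ))

SkeletalBranch : ∀ {n s q} → Branch n s q → Set
SkeletalBranch leaf          = ⊤
SkeletalBranch (n ∷⟨ _ ⟩ b) = SkeletalNode n × SkeletalBranch b

data Polarity : Set where
  𝟏 ∂ : Polarity

OrderType : ℕ → Set
OrderType n = Fin n → Polarity

criticalSign : Polarity → Sign
criticalSign 𝟏 = +
criticalSign ∂ = -

Critical : ∀ {n} → (Fin n → PropVar) → OrderType n → Sign → PropVar → Set
Critical ps ε s q = ∃[ k ] ps k ≡ q × criticalSign (ε k) ≡ s

EpsSkeletal : ∀ {n} → (Fin n → PropVar) → OrderType n → Node → Set
EpsSkeletal ps ε n =
  ∀ {s q} (b : Branch n s q) → Critical ps ε s q → SkeletalBranch b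

-- The propositional variables of a formula are the variables labelling
-- leaves of its generation tree.
VarsAmong : ∀ {n} → (Fin n → PropVar) → Form → Set
VarsAmong ps φ = ∀ {s q} → Branch (+ ∙ φ) s q → ∃[ k ] ps k ≡ q

data SkeletalSahlqvist : Form → Set where
  skeletal : ∀ {φ ψ n} (ps : Fin n → PropVar) → Injective _≡_ _≡_ ps →
             VarsAmong ps (φ ⇒ ψ) → (ε : OrderType n) →
             EpsSkeletal ps ε (+ ∙ φ) → EpsSkeletal ps ε (- ∙ ψ) →
             SkeletalSahlqvist (φ ⇒ ψ)

{-# OPTIONS --safe #-}
-- Soundness is an induction on derivations. For completeness, a consistent set
-- is copied with its nominals and free state variables turned into new nominals
-- and extended to a maximal theory of @-formulas in which every @_i ◇ ψ has a
-- witnessing nominal; Name-↓ and BG-↓ make this possible. In its canonical model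
-- every point is named by a nominal, and every closed instance of a theorem is
-- true. The canonical frame validates a skeletal formula φ → ψ of Σ: evaluating
-- + φ and - ψ in a refutation inspects, at critical leaves, only finitely many
-- points (□ is not skeletal in + φ, nor ◇ in - ψ), and all other leaves are
-- monotone the other way, so each variable may be shrunk to a finite set of
-- points. Finite sets are defined by disjunctions of nominals, so an instance of
-- φ → ψ obtained by SB would fail in the canonical model.
module Submission where

open import Defs
open import Axiom.ExcludedMiddle using (ExcludedMiddle)
open import Data.Bool.Base using (true; false; not; _∧_; _∨_)
open import Data.Empty using (⊥; ⊥-elim)
open import Data.Fin.Base using (Fin)
open import Data.List.Base using (List; []; _∷_; _++_; map; upTo; cartesianProductWith; concat)
open import Data.List.Membership.DecPropositional using (_∈?_)
open import Data.List.Membership.Propositional using () renaming (_∈_ to _∈ₗ_; _∉_ to _∉ₗ_)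
open import Data.List.Membership.Propositional.Properties using
  (∈-map⁺; ∈-upTo⁺; ∈-++⁺ˡ; ∈-++⁺ʳ; ∈-cartesianProductWith⁺; ∈-concat⁺′)
open import Data.List.Relation.Unary.All as All using (All; []; _∷_; universal; tabulate; lookup)
open import Data.List.Relation.Unary.All.Properties using (++⁺; ++⁻)
open import Data.List.Relation.Unary.Any using (here; there)
open import Data.Nat.Base using (ℕ; zero; suc; _≤_; z≤n; s≤s; _⊔_; _≤′_; ≤′-refl; ≤′-step)
open import Data.Nat.Properties using
  (_≟_; ≤-refl; ≤-trans; ≤-antisym; ≤⇒≤′; m≤m⊔n; m≤n⊔m; m≤n+m; n≤1+n; <-irrefl;
   ≡-irrelevant)
open import Data.Product.Base as Product using (_×_; _,_; proj₁; proj₂; ∃-syntax; Σ-syntax; map₂)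
open import Data.Product.Function.NonDependent.Propositional using (_×-⇔_)
open import Data.Sign.Base using (Sign; +; -; opposite)
import Data.Sign.Properties as Sign
open import Data.Sum.Base as Sum using (_⊎_; inj₁; inj₂; [_,_]′)
open import Data.Sum.Function.Propositional using (_⊎-⇔_)
open import Data.Unit.Base using (tt)
open import Function.Base using (_∘_; id)
open import Function.Bundles using (_⇔_; mk⇔; module Equivalence)
open import Function.Construct.Composition using (_⇔-∘_)
open import Function.Construct.Identity using (⇔-id)
open import Function.Related.TypeIsomorphisms using (→-cong-⇔; ¬-cong-⇔)
open import Level using (0ℓ)
open import Relation.Binary.PropositionalEquality using
  (_≡_; _≢_; refl; sym; trans; cong; cong₂)
  renaming (subst to transport)
open import Relation.Nullary using (¬_; Dec; yes; no; does; proof; contradiction)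
open import Relation.Nullary.Decidable using (dec-true; dec-false; decidable-stable)
open import Relation.Nullary.Reflects using
  (Reflects; ofʸ; ofⁿ; invert; ¬-reflects; _×-reflects_; _⊎-reflects_; _→-reflects_)
open import Relation.Unary using (Pred; _∈_; _⊆_)

open Equivalence using (to; from)

-- Syntax

-- Validity in the canonical frame ranges over all valuations and assignments, whereas the maximal
-- theory controls only definable sets and its own nominals. SB closes the gap because it replaces
-- nominals and state variables as well: every point has a name, so the values of a given `Vnom V`
-- and `g` can be written into the instance, and only propositional variables need shrinking. Hence
-- the truth lemma is proved for closed substitution instances of a formula rather than for the
-- formula alone. Theories consist of @-formulas because these do not depend on the point of
-- evaluation: they pass under □, so a single theory describes the whole model. Free state variables
-- become nominals because DA and the @-axioms speak of nominals only. Substitution never renames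
-- bound variables, so it composes, and commutes with satisfaction, only in the absence of capture;
-- the syntactic lemmas isolate conditions that exclude it.

≔-same : ∀ {A : Set} (g : Svar → A) x {w} → (g ⟨ x ≔ w ⟩) x ≡ w
≔-same g x rewrite dec-true (x ≟ x) refl = refl

≔-other : ∀ {A : Set} (g : Svar → A) {x y w} → y ≢ x → (g ⟨ x ≔ w ⟩) y ≡ g y
≔-other g {x} {y} y≢x rewrite dec-false (y ≟ x) y≢x = refl

≔-elim : ∀ {A : Set} (P : Svar → A → Set) (g : Svar → A) x {w} →
         P x w → (∀ y → y ≢ x → P y (g y)) → ∀ y → P y ((g ⟨ x ≔ w ⟩) y)
≔-elim P g x same other y with y ≟ x
... | yes refl = transport (P y) (sym (≔-same g y)) same
... | no y≢x   = transport (P y) (sym (≔-other g y≢x)) (other y y≢x)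

≔-cong : ∀ {A : Set} {g h : Svar → A} {x w} y → (y ≢ x → g y ≡ h y) →
         (g ⟨ x ≔ w ⟩) y ≡ (h ⟨ x ≔ w ⟩) y
≔-cong {g = g} {h} {x} y g≡h with y ≟ x
... | yes refl = trans (≔-same g y) (sym (≔-same h y))
... | no y≢x   = trans (≔-other g y≢x) (trans (g≡h y≢x) (sym (≔-other h y≢x)))

NomIn : Nom → Form → Set
NomIn i (var p)  = ⊥
NomIn i (tm t)   = t ≡ nm i
NomIn i ⊥′       = ⊥
NomIn i ⊤′       = ⊥
NomIn i (¬′ φ)   = NomIn i φ
NomIn i (φ ∨′ ψ) = NomIn i φ ⊎ NomIn i ψ
NomIn i (φ ∧′ ψ) = NomIn i φ ⊎ NomIn i ψ
NomIn i (φ ⇒ ψ)  = NomIn i φ ⊎ NomIn i ψ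
NomIn i (◇ φ)    = NomIn i φ
NomIn i (□ φ)    = NomIn i φ
NomIn i (at t φ) = t ≡ nm i ⊎ NomIn i φ
NomIn i (↓ y φ)  = NomIn i φ

Bounded : (ℕ → Set) → Set
Bounded P = ∃[ n ] ∀ {m} → n ≤ m → ¬ P m

bounded-⊥ : Bounded (λ _ → ⊥)
bounded-⊥ = 0 , λ _ ()

bounded-⊎ : ∀ {P Q} → Bounded P → Bounded Q → Bounded (λ m → P m ⊎ Q m)
bounded-⊎ (k , k-bounds) (l , l-bounds) =
  k ⊔ l , λ k⊔l≤m → [ k-bounds (≤-trans (m≤m⊔n k l) k⊔l≤m)
                    , l-bounds (≤-trans (m≤n⊔m k l) k⊔l≤m) ]′

bounded-≡ : ∀ n → Bounded (_≡ n)
bounded-≡ n = suc n , λ { n<n refl → <-irrefl refl n<n }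

svar-bounded : ∀ t → Bounded (λ x → t ≡ sv x)
svar-bounded (sv y) = suc y , λ { y<y refl → <-irrefl refl y<y }
svar-bounded (nm i) = 0 , λ _ ()

nom-bounded : ∀ t → Bounded (λ i → t ≡ nm i)
nom-bounded (sv y) = 0 , λ _ ()
nom-bounded (nm i) = suc i , λ { i<i refl → <-irrefl refl i<i }

OccursIn-bounded : ∀ φ → Bounded (λ x → OccursIn x φ)
OccursIn-bounded (var p)  = bounded-⊥
OccursIn-bounded (tm t)   = svar-bounded t
OccursIn-bounded ⊥′       = bounded-⊥
OccursIn-bounded ⊤′       = bounded-⊥
OccursIn-bounded (¬′ φ)   = OccursIn-bounded φ
OccursIn-bounded (φ ∨′ ψ) = bounded-⊎ (OccursIn-bounded φ) (OccursIn-bounded ψ)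
OccursIn-bounded (φ ∧′ ψ) = bounded-⊎ (OccursIn-bounded φ) (OccursIn-bounded ψ)
OccursIn-bounded (φ ⇒ ψ)  = bounded-⊎ (OccursIn-bounded φ) (OccursIn-bounded ψ)
OccursIn-bounded (◇ φ)    = OccursIn-bounded φ
OccursIn-bounded (□ φ)    = OccursIn-bounded φ
OccursIn-bounded (at t φ) = bounded-⊎ (svar-bounded t) (OccursIn-bounded φ)
OccursIn-bounded (↓ y φ)  = bounded-⊎ (bounded-≡ y) (OccursIn-bounded φ)

NomIn-bounded : ∀ φ → Bounded (λ i → NomIn i φ)
NomIn-bounded (var p)  = bounded-⊥
NomIn-bounded (tm t)   = nom-bounded t
NomIn-bounded ⊥′       = bounded-⊥
NomIn-bounded ⊤′       = bounded-⊥
NomIn-bounded (¬′ φ)   = NomIn-bounded φ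
NomIn-bounded (φ ∨′ ψ) = bounded-⊎ (NomIn-bounded φ) (NomIn-bounded ψ)
NomIn-bounded (φ ∧′ ψ) = bounded-⊎ (NomIn-bounded φ) (NomIn-bounded ψ)
NomIn-bounded (φ ⇒ ψ)  = bounded-⊎ (NomIn-bounded φ) (NomIn-bounded ψ)
NomIn-bounded (◇ φ)    = NomIn-bounded φ
NomIn-bounded (□ φ)    = NomIn-bounded φ
NomIn-bounded (at t φ) = bounded-⊎ (nom-bounded t) (NomIn-bounded φ)
NomIn-bounded (↓ y φ)  = NomIn-bounded φ

FreeIn⇒OccursIn : ∀ {x} φ → FreeIn x φ → OccursIn x φ
FreeIn⇒OccursIn (tm t)   t≡x             = t≡x
FreeIn⇒OccursIn (¬′ φ)   free            = FreeIn⇒OccursIn φ free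
FreeIn⇒OccursIn (φ ∨′ ψ) (inj₁ free)     = inj₁ (FreeIn⇒OccursIn φ free)
FreeIn⇒OccursIn (φ ∨′ ψ) (inj₂ free)     = inj₂ (FreeIn⇒OccursIn ψ free)
FreeIn⇒OccursIn (φ ∧′ ψ) (inj₁ free)     = inj₁ (FreeIn⇒OccursIn φ free)
FreeIn⇒OccursIn (φ ∧′ ψ) (inj₂ free)     = inj₂ (FreeIn⇒OccursIn ψ free)
FreeIn⇒OccursIn (φ ⇒ ψ)  (inj₁ free)     = inj₁ (FreeIn⇒OccursIn φ free)
FreeIn⇒OccursIn (φ ⇒ ψ)  (inj₂ free)     = inj₂ (FreeIn⇒OccursIn ψ free)
FreeIn⇒OccursIn (◇ φ)    free            = FreeIn⇒OccursIn φ free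
FreeIn⇒OccursIn (□ φ)    free            = FreeIn⇒OccursIn φ free
FreeIn⇒OccursIn (at t φ) (inj₁ t≡x)      = inj₁ t≡x
FreeIn⇒OccursIn (at t φ) (inj₂ free)     = inj₂ (FreeIn⇒OccursIn φ free)
FreeIn⇒OccursIn (↓ y φ)  (x≢y , free)    = inj₂ (FreeIn⇒OccursIn φ free)

-- Substitution: congruence, safety and composition

substTerm-cong : ∀ {σ τ} t → (∀ x → t ≡ sv x → onSvar σ x ≡ onSvar τ x) →
                 (∀ i → t ≡ nm i → onNom σ i ≡ onNom τ i) → substTerm σ t ≡ substTerm τ t
substTerm-cong (sv x) svs nms = svs x refl
substTerm-cong (nm i) svs nms = nms i refl

subst-cong : ∀ {σ τ} φ → (∀ p → onProp σ p ≡ onProp τ p) →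
             (∀ x → FreeIn x φ → onSvar σ x ≡ onSvar τ x) →
             (∀ i → NomIn i φ → onNom σ i ≡ onNom τ i) → subst σ φ ≡ subst τ φ
subst-cong (var p)  ps svs nms = ps p
subst-cong (tm t)   ps svs nms = cong tm (substTerm-cong t svs nms)
subst-cong ⊥′       ps svs nms = refl
subst-cong ⊤′       ps svs nms = refl
subst-cong (¬′ φ)   ps svs nms = cong ¬′_ (subst-cong φ ps svs nms)
subst-cong (φ ∨′ ψ) ps svs nms = cong₂ _∨′_
  (subst-cong φ ps (λ x → svs x ∘ inj₁) (λ i → nms i ∘ inj₁))
  (subst-cong ψ ps (λ x → svs x ∘ inj₂) (λ i → nms i ∘ inj₂))
subst-cong (φ ∧′ ψ) ps svs nms = cong₂ _∧′_
  (subst-cong φ ps (λ x → svs x ∘ inj₁) (λ i → nms i ∘ inj₁))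
  (subst-cong ψ ps (λ x → svs x ∘ inj₂) (λ i → nms i ∘ inj₂))
subst-cong (φ ⇒ ψ)  ps svs nms = cong₂ _⇒_
  (subst-cong φ ps (λ x → svs x ∘ inj₁) (λ i → nms i ∘ inj₁))
  (subst-cong ψ ps (λ x → svs x ∘ inj₂) (λ i → nms i ∘ inj₂))
subst-cong (◇ φ)    ps svs nms = cong ◇_ (subst-cong φ ps svs nms)
subst-cong (□ φ)    ps svs nms = cong □_ (subst-cong φ ps svs nms)
subst-cong (at t φ) ps svs nms = cong₂ at
  (substTerm-cong t (λ x → svs x ∘ inj₁) (λ i → nms i ∘ inj₁))
  (subst-cong φ ps (λ x → svs x ∘ inj₂) (λ i → nms i ∘ inj₂))
subst-cong {σ} {τ} (↓ y φ) ps svs nms = cong (↓ y)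
  (subst-cong φ ps (λ x free → ≔-cong {g = onSvar σ} {onSvar τ} x (λ x≢y → svs x (x≢y , free))) nms)

substTerm-id : ∀ {σ} t → (∀ x → onSvar σ x ≡ sv x) → (∀ i → onNom σ i ≡ nm i) →
               substTerm σ t ≡ t
substTerm-id (sv x) svs nms = svs x
substTerm-id (nm i) svs nms = nms i

subst-id : ∀ {σ} φ → (∀ p → onProp σ p ≡ var p) → (∀ x → onSvar σ x ≡ sv x) →
           (∀ i → onNom σ i ≡ nm i) → subst σ φ ≡ φ
subst-id (var p)  ps svs nms = ps p
subst-id (tm t)   ps svs nms = cong tm (substTerm-id t svs nms)
subst-id ⊥′       ps svs nms = refl
subst-id ⊤′       ps svs nms = refl
subst-id (¬′ φ)   ps svs nms = cong ¬′_ (subst-id φ ps svs nms)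
subst-id (φ ∨′ ψ) ps svs nms = cong₂ _∨′_ (subst-id φ ps svs nms) (subst-id ψ ps svs nms)
subst-id (φ ∧′ ψ) ps svs nms = cong₂ _∧′_ (subst-id φ ps svs nms) (subst-id ψ ps svs nms)
subst-id (φ ⇒ ψ)  ps svs nms = cong₂ _⇒_ (subst-id φ ps svs nms) (subst-id ψ ps svs nms)
subst-id (◇ φ)    ps svs nms = cong ◇_ (subst-id φ ps svs nms)
subst-id (□ φ)    ps svs nms = cong □_ (subst-id φ ps svs nms)
subst-id (at t φ) ps svs nms = cong₂ at (substTerm-id t svs nms) (subst-id φ ps svs nms)
subst-id {σ} (↓ y φ) ps svs nms = cong (↓ y)
  (subst-id φ ps (≔-elim (λ x t → t ≡ sv x) (onSvar σ) y refl (λ x _ → svs x)) nms)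

subst-fixed : ∀ {σ} φ → (∀ p → onProp σ p ≡ var p) →
              (∀ x → FreeIn x φ → onSvar σ x ≡ sv x) →
              (∀ i → NomIn i φ → onNom σ i ≡ nm i) → subst σ φ ≡ φ
subst-fixed φ ps svs nms = trans (subst-cong {τ = idSubst} φ ps svs nms)
  (subst-id φ (λ _ → refl) (λ _ → refl) (λ _ → refl))

-- Capture is excluded by conditions that mention no list of enclosing binders: whatever replaces a
-- propositional variable has no free state variable, and a state variable is kept or becomes a
-- nominal. Such conditions survive every binder passed on the way down.
PropClosed OwnSvar : Subst → Set
PropClosed σ = ∀ p {y} → ¬ FreeIn y (onProp σ p)
OwnSvar σ = ∀ x {y} → FreeInTerm y (onSvar σ x) → x ≡ y

NomClosed : Subst → Form → Set
NomClosed σ φ = ∀ i → NomIn i φ → ∀ {y} → ¬ FreeInTerm y (onNom σ i)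

ownSvar-update : ∀ {σ} y → OwnSvar σ → OwnSvar (σ [ y ↦ sv y ])
ownSvar-update {σ} y own = ≔-elim (λ x t → ∀ {z} → FreeInTerm z t → x ≡ z) (onSvar σ) y
  (λ { refl → refl }) (λ x _ → own x)

all-absent : ∀ {B : List Svar} {P : Svar → Set} → (∀ {y} → ¬ P y) → All (λ y → ¬ P y) B
all-absent absent = universal (λ _ → absent) _

ownSvar-safeTerm : ∀ {σ} B t → OwnSvar σ →
  (∀ i → t ≡ nm i → ∀ {y} → ¬ FreeInTerm y (onNom σ i)) → SafeTermUnder B σ t
ownSvar-safeTerm B (nm i) own nms = all-absent (nms i refl)
ownSvar-safeTerm B (sv x) own nms with _∈?_ _≟_ x B
... | yes x∈B = inj₁ x∈B
... | no x∉B  = inj₂ (tabulate λ y∈B free → x∉B (transport (_∈ₗ B) (sym (own x free)) y∈B))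

closed-safe : ∀ {σ} B φ → PropClosed σ → OwnSvar σ → NomClosed σ φ → SafeUnder B σ φ
closed-safe B (var p)  ps own nms = all-absent (ps p)
closed-safe B (tm t)   ps own nms = ownSvar-safeTerm B t own nms
closed-safe B ⊥′       ps own nms = tt
closed-safe B ⊤′       ps own nms = tt
closed-safe B (¬′ φ)   ps own nms = closed-safe B φ ps own nms
closed-safe B (φ ∨′ ψ) ps own nms =
  closed-safe B φ ps own (λ i → nms i ∘ inj₁) , closed-safe B ψ ps own (λ i → nms i ∘ inj₂)
closed-safe B (φ ∧′ ψ) ps own nms =
  closed-safe B φ ps own (λ i → nms i ∘ inj₁) , closed-safe B ψ ps own (λ i → nms i ∘ inj₂)
closed-safe B (φ ⇒ ψ)  ps own nms =
  closed-safe B φ ps own (λ i → nms i ∘ inj₁) , closed-safe B ψ ps own (λ i → nms i ∘ inj₂)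
closed-safe B (◇ φ)    ps own nms = closed-safe B φ ps own nms
closed-safe B (□ φ)    ps own nms = closed-safe B φ ps own nms
closed-safe B (at t φ) ps own nms =
  ownSvar-safeTerm B t own (λ i → nms i ∘ inj₁) , closed-safe B φ ps own (λ i → nms i ∘ inj₂)
closed-safe B (↓ y φ)  ps own nms = closed-safe (y ∷ B) φ ps own nms

substTerm-update : ∀ {τ y u} t → ¬ FreeInTerm y t → substTerm (τ [ y ↦ u ]) t ≡ substTerm τ t
substTerm-update {τ} (sv x) y∉t = ≔-other (onSvar τ) λ { refl → y∉t refl }
substTerm-update (nm i) y∉t = refl

-- The first three fields keep `σ` from inserting a variable that a binder would then protect from
-- `τ`. All six survive when the three substitutions are updated at the same bound variable, which
-- is what the induction needs at ↓.
record Composite (σ τ ρ : Subst) : Set where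
  field
    propClosed : PropClosed σ
    ownSvar    : OwnSvar σ
    nomClosed  : ∀ i {y} → ¬ FreeInTerm y (onNom σ i)
    props      : ∀ p → subst τ (onProp σ p) ≡ onProp ρ p
    svars      : ∀ x → substTerm τ (onSvar σ x) ≡ onSvar ρ x
    noms       : ∀ i → substTerm τ (onNom σ i) ≡ onNom ρ i

composite-update : ∀ {σ τ ρ} y → Composite σ τ ρ →
  Composite (σ [ y ↦ sv y ]) (τ [ y ↦ sv y ]) (ρ [ y ↦ sv y ])
composite-update {σ} {τ} {ρ} y c = record
  { propClosed = propClosed
  ; ownSvar    = ownSvar-update {σ} y ownSvar
  ; nomClosed  = nomClosed
  ; props      = λ p → trans (subst-cong (onProp σ p) (λ _ → refl)
                   (λ x free → ⊥-elim (propClosed p free)) (λ _ _ → refl)) (props p)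
  ; svars      = ≔-elim (λ x t → substTerm (τ [ y ↦ sv y ]) t ≡ onSvar (ρ [ y ↦ sv y ]) x)
                   (onSvar σ) y
                   (trans (≔-same (onSvar τ) y) (sym (≔-same (onSvar ρ) y)))
                   (λ x x≢y → trans (substTerm-update (onSvar σ x) (x≢y ∘ ownSvar x))
                     (trans (svars x) (sym (≔-other (onSvar ρ) x≢y))))
  ; noms       = λ i → trans (substTerm-update (onNom σ i) (nomClosed i)) (noms i)
  }
  where open Composite c

subst-composite : ∀ {σ τ ρ} φ → Composite σ τ ρ → subst τ (subst σ φ) ≡ subst ρ φ
subst-composite (var p)      c = Composite.props c p
subst-composite (tm (sv x))  c = cong tm (Composite.svars c x)
subst-composite (tm (nm i))  c = cong tm (Composite.noms c i)
subst-composite ⊥′           c = refl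
subst-composite ⊤′           c = refl
subst-composite (¬′ φ)       c = cong ¬′_ (subst-composite φ c)
subst-composite (φ ∨′ ψ)     c = cong₂ _∨′_ (subst-composite φ c) (subst-composite ψ c)
subst-composite (φ ∧′ ψ)     c = cong₂ _∧′_ (subst-composite φ c) (subst-composite ψ c)
subst-composite (φ ⇒ ψ)      c = cong₂ _⇒_ (subst-composite φ c) (subst-composite ψ c)
subst-composite (◇ φ)        c = cong ◇_ (subst-composite φ c)
subst-composite (□ φ)        c = cong □_ (subst-composite φ c)
subst-composite (at (sv x) φ) c = cong₂ at (Composite.svars c x) (subst-composite φ c)
subst-composite (at (nm i) φ) c = cong₂ at (Composite.noms c i) (subst-composite φ c)
subst-composite (↓ y φ)      c = cong (↓ y) (subst-composite φ (composite-update y c))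

-- Soundness

∃-⇔ : ∀ {A : Set} {P Q : A → Set} → (∀ a → P a ⇔ Q a) → (∃[ a ] P a) ⇔ (∃[ a ] Q a)
∃-⇔ P⇔Q = mk⇔ (map₂ (to (P⇔Q _))) (map₂ (from (P⇔Q _)))

∀-⇔ : ∀ {A : Set} {P Q : A → Set} → (∀ a → P a ⇔ Q a) → (∀ a → P a) ⇔ (∀ a → Q a)
∀-⇔ P⇔Q = mk⇔ (λ f a → to (P⇔Q a) (f a)) (λ f a → from (P⇔Q a) (f a))

≡-⇔ : ∀ {A : Set} {a b c : A} → a ≡ b → (a ≡ c) ⇔ (b ≡ c)
≡-⇔ refl = ⇔-id _

value-cong : ∀ {F} (V : Valuation F) {g h} t → (∀ x → FreeInTerm x t → g x ≡ h x) →
             ⟦ t ⟧ V g ≡ ⟦ t ⟧ V h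
value-cong V (sv x) g≡h = g≡h x refl
value-cong V (nm i) g≡h = refl

Sat-cong : ∀ {F} (V : Valuation F) {g h} φ → (∀ x → FreeIn x φ → g x ≡ h x) →
           ∀ {w} → Sat F V g w φ ⇔ Sat F V h w φ
Sat-cong V (var p)  g≡h = ⇔-id _
Sat-cong V (tm t)   g≡h = ≡-⇔ (value-cong V t g≡h)
Sat-cong V ⊥′       g≡h = ⇔-id _
Sat-cong V ⊤′       g≡h = ⇔-id _
Sat-cong V (¬′ φ)   g≡h = ¬-cong-⇔ (Sat-cong V φ g≡h)
Sat-cong V (φ ∨′ ψ) g≡h =
  Sat-cong V φ (λ x → g≡h x ∘ inj₁) ⊎-⇔ Sat-cong V ψ (λ x → g≡h x ∘ inj₂)
Sat-cong V (φ ∧′ ψ) g≡h =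
  Sat-cong V φ (λ x → g≡h x ∘ inj₁) ×-⇔ Sat-cong V ψ (λ x → g≡h x ∘ inj₂)
Sat-cong V (φ ⇒ ψ)  g≡h =
  →-cong-⇔ (Sat-cong V φ (λ x → g≡h x ∘ inj₁)) (Sat-cong V ψ (λ x → g≡h x ∘ inj₂))
Sat-cong V (◇ φ)    g≡h = ∃-⇔ λ v → ⇔-id _ ×-⇔ Sat-cong V φ g≡h
Sat-cong V (□ φ)    g≡h = ∀-⇔ λ v → →-cong-⇔ (⇔-id _) (Sat-cong V φ g≡h)
Sat-cong V (at t φ) g≡h rewrite value-cong V t (λ x → g≡h x ∘ inj₁) =
  Sat-cong V φ (λ x → g≡h x ∘ inj₂)
Sat-cong V {g} {h} (↓ y φ) g≡h =
  Sat-cong V φ (λ x free → ≔-cong {g = g} {h} x (λ x≢y → g≡h x (x≢y , free)))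

module _ {F : Frame} {V V′ : Valuation F} (σ : Subst) (g₀ : Assignment F)
         (props : ∀ p {w} → (w ∈ Vprop V′ p) ⇔ Sat F V g₀ w (onProp σ p))
         (noms : ∀ i → Vnom V′ i ≡ ⟦ onNom σ i ⟧ V g₀) where

  -- τ, g and g′ are what σ, g₀ and the assignment interpreting σ become
  -- below binders for the variables in B.
  record Below (B : List Svar) (τ : Subst) (g g′ : Assignment F) : Set where
    field
      sameProp : ∀ p → onProp τ p ≡ onProp σ p
      sameNom  : ∀ i → onNom τ i ≡ onNom σ i
      bound    : ∀ {x} → x ∈ₗ B → onSvar τ x ≡ sv x × g′ x ≡ g x
      unbound  : ∀ {x} → x ∉ₗ B →
                 onSvar τ x ≡ onSvar σ x × g′ x ≡ ⟦ onSvar σ x ⟧ V g₀ × g x ≡ g₀ x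

  below-binder : ∀ {B τ g g′} y w → Below B τ g g′ →
                 Below (y ∷ B) (τ [ y ↦ sv y ]) (g ⟨ y ≔ w ⟩) (g′ ⟨ y ≔ w ⟩)
  below-binder {B} {τ} {g} {g′} y w below = record
    { sameProp = sameProp
    ; sameNom  = sameNom
    ; bound    = λ {x} x∈ → boundAt x x∈ (x ≟ y)
    ; unbound  = λ x∉ → let x≢y = x∉ ∘ here in
        trans (≔-other (onSvar τ) x≢y) (proj₁ (unbound (x∉ ∘ there))) ,
        trans (≔-other g′ x≢y) (proj₁ (proj₂ (unbound (x∉ ∘ there)))) ,
        trans (≔-other g x≢y) (proj₂ (proj₂ (unbound (x∉ ∘ there))))
    }
    where
    open Below below
    boundAt : ∀ x → x ∈ₗ y ∷ B → Dec (x ≡ y) →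
              onSvar (τ [ y ↦ sv y ]) x ≡ sv x × (g′ ⟨ y ≔ w ⟩) x ≡ (g ⟨ y ≔ w ⟩) x
    boundAt x x∈          (yes refl) =
      ≔-same (onSvar τ) y , trans (≔-same g′ y) (sym (≔-same g y))
    boundAt x (here x≡y)  (no x≢y)   = contradiction x≡y x≢y
    boundAt x (there x∈B) (no x≢y)   =
      trans (≔-other (onSvar τ) x≢y) (proj₁ (bound x∈B)) ,
      trans (≔-other g′ x≢y) (trans (proj₂ (bound x∈B)) (sym (≔-other g x≢y)))

  module _ {B τ g g′} (below : Below B τ g g′) where
    open Below below

    -- What `σ` inserts is meant at the outer assignment `g₀` but evaluated at `g`. The two differ
    -- at most on `B`, and safety keeps `B` out of the free variables of `t`.
    value-unbound : ∀ t → All (λ y → ¬ FreeInTerm y t) B → ⟦ t ⟧ V g₀ ≡ ⟦ t ⟧ V g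
    value-unbound t absent = value-cong V t
      (λ x free → sym (proj₂ (proj₂ (unbound λ x∈B → lookup absent x∈B free))))

    value-subst : ∀ t → SafeTermUnder B σ t → ⟦ t ⟧ V′ g′ ≡ ⟦ substTerm τ t ⟧ V g
    value-subst (nm i) safe =
      trans (noms i) (trans (value-unbound (onNom σ i) safe) (sym (cong (λ t → ⟦ t ⟧ V g) (sameNom i))))
    value-subst (sv x) safe with _∈?_ _≟_ x B
    ... | yes x∈B = trans (proj₂ (bound x∈B)) (sym (cong (λ t → ⟦ t ⟧ V g) (proj₁ (bound x∈B))))
    ... | no x∉B with safe
    ...   | inj₁ x∈B    = contradiction x∈B x∉B
    ...   | inj₂ absent =
      trans (proj₁ (proj₂ (unbound x∉B)))
        (trans (value-unbound (onSvar σ x) absent)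
          (sym (cong (λ t → ⟦ t ⟧ V g) (proj₁ (unbound x∉B)))))

  Sat-substUnder : ∀ {B τ g g′} φ → Below B τ g g′ → SafeUnder B σ φ →
             ∀ {w} → Sat F V′ g′ w φ ⇔ Sat F V g w (subst τ φ)
  Sat-substUnder {g = g} (var p) below safe rewrite Below.sameProp below p =
    Sat-cong V (onProp σ p)
      (λ x free → sym (proj₂ (proj₂ (Below.unbound below λ x∈B → lookup safe x∈B free))))
    ⇔-∘ props p
  Sat-substUnder (tm t)   below safe = ≡-⇔ (value-subst below t safe)
  Sat-substUnder ⊥′       below safe = ⇔-id _
  Sat-substUnder ⊤′       below safe = ⇔-id _
  Sat-substUnder (¬′ φ)   below safe = ¬-cong-⇔ (Sat-substUnder φ below safe)
  Sat-substUnder (φ ∨′ ψ) below (safeφ , safeψ) =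
    Sat-substUnder φ below safeφ ⊎-⇔ Sat-substUnder ψ below safeψ
  Sat-substUnder (φ ∧′ ψ) below (safeφ , safeψ) =
    Sat-substUnder φ below safeφ ×-⇔ Sat-substUnder ψ below safeψ
  Sat-substUnder (φ ⇒ ψ)  below (safeφ , safeψ) =
    →-cong-⇔ (Sat-substUnder φ below safeφ) (Sat-substUnder ψ below safeψ)
  Sat-substUnder (◇ φ)    below safe = ∃-⇔ λ v → ⇔-id _ ×-⇔ Sat-substUnder φ below safe
  Sat-substUnder (□ φ)    below safe = ∀-⇔ λ v → →-cong-⇔ (⇔-id _) (Sat-substUnder φ below safe)
  Sat-substUnder (at t φ) below (safet , safeφ) rewrite value-subst below t safet =
    Sat-substUnder φ below safeφ
  Sat-substUnder (↓ y φ)  below safe {w} = Sat-substUnder φ (below-binder y w below) safe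

  Sat-subst : ∀ {g′} φ → (∀ x → g′ x ≡ ⟦ onSvar σ x ⟧ V g₀) → Safe σ φ →
              ∀ {w} → Sat F V′ g′ w φ ⇔ Sat F V g₀ w (subst σ φ)
  Sat-subst φ svars = Sat-substUnder φ record
    { sameProp = λ _ → refl
    ; sameNom  = λ _ → refl
    ; bound    = λ ()
    ; unbound  = λ {x} _ → refl , svars x , refl
    }

[/]-safe : ∀ i x φ → Safe (idSubst [ x ↦ nm i ]) φ
[/]-safe i x φ = closed-safe [] φ (λ _ ())
  (≔-elim (λ y t → ∀ {z} → FreeInTerm z t → y ≡ z) sv x (λ ()) (λ { y _ refl → refl })) (λ _ _ ())

⋀-sat : ∀ {F V g w} γs → All (Sat F V g w) γs → Sat F V g w (⋀ γs)
⋀-sat [] [] = tt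
⋀-sat (γ ∷ γs) (sat ∷ sats) = sat , ⋀-sat γs sats

module _ (em : ExcludedMiddle 0ℓ) where

  -- Satisfaction at one point is itself a truth-functional evaluation once excluded middle decides
  -- the formulas whose main symbol is not Boolean; this makes tautologies valid.
  eval-reflects : ∀ {F V g w} φ → Reflects (Sat F V g w φ) (eval (λ ψ → does (em {Sat F V g w ψ})) φ)
  eval-reflects (var p)  = proof em
  eval-reflects (tm t)   = proof em
  eval-reflects ⊥′       = ofⁿ λ ()
  eval-reflects ⊤′       = ofʸ tt
  eval-reflects (¬′ φ)   = ¬-reflects (eval-reflects φ)
  eval-reflects (φ ∨′ ψ) = eval-reflects φ ⊎-reflects eval-reflects ψ
  eval-reflects (φ ∧′ ψ) = eval-reflects φ ×-reflects eval-reflects ψ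
  eval-reflects (φ ⇒ ψ)  = eval-reflects φ →-reflects eval-reflects ψ
  eval-reflects (◇ φ)    = proof em
  eval-reflects (□ φ)    = proof em
  eval-reflects (at t φ) = proof em
  eval-reflects (↓ x φ)  = proof em

  axiom-valid : ∀ {φ} → Axiom φ → ∀ F → F ⊩ φ
  axiom-valid (taut {φ} φ-taut) F V g w =
    invert (transport (Reflects _) (φ-taut _) (eval-reflects φ))
  axiom-valid (dual p) F V g w =
    (λ { (v , Rwv , Pv) none → none v Rwv Pv }) ,
    (λ notNone → decidable-stable em λ none → notNone λ v Rwv Pv → none (v , Rwv , Pv))
  axiom-valid (K p q) F V g w P⇒Q P v Rwv = P⇒Q v Rwv (P v Rwv)
  axiom-valid (K-at i p q) F V g w = id
  axiom-valid (selfdual i p) F V g w = id , id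
  axiom-valid (ref i) F V g w = refl
  axiom-valid (intro i p) F V g w (refl , Pw) = Pw
  axiom-valid (back i p) F V g w (_ , _ , Pi) = Pi
  axiom-valid (agree i j p) F V g w = id
  axiom-valid (DA i x φ) F V g w = to Sat-[i/x] , from Sat-[i/x]
    where
    Sat-[i/x] : Sat F V (g ⟨ x ≔ Vnom V i ⟩) (Vnom V i) φ ⇔ Sat F V g (Vnom V i) (φ [ i / x ])
    Sat-[i/x] = Sat-subst (idSubst [ x ↦ nm i ]) g (λ _ → ⇔-id _) (λ _ → refl) φ
      (λ y → ≔-elim (λ y t → (g ⟨ x ≔ Vnom V i ⟩) y ≡ ⟦ t ⟧ V g) sv x
        (≔-same g x) (λ _ → ≔-other g) y)
      ([/]-safe i x φ)
  axiom-valid (name-↓ x φ x∉φ) F V g w sat = to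
    (Sat-cong V φ λ y free → ≔-other g λ { refl → x∉φ (FreeIn⇒OccursIn φ free) })
    (transport (λ v → Sat F V (g ⟨ x ≔ w ⟩) v φ) (≔-same g x) sat)
  axiom-valid (BG-↓ i x) F V g w v Riv = v , Riv , ≔-same g x

  soundness : ∀ {Σ φ} → Σ ⊢ φ → ∀ {F} → F ∈ FramesDefinedBy Σ → F ⊩ φ
  soundness (ax a) F∈ = axiom-valid a _
  soundness (extra φ∈Σ) F∈ = F∈ φ∈Σ
  soundness (MP d e) F∈ V g w = soundness d F∈ V g w (soundness e F∈ V g w)
  soundness (SB {φ} σ safe d) F∈ V g w = to
    -- The premise is used at another model on the same frame: each symbol receives the meaning that
    -- its image under `σ` has at `V` and `g`.
    (Sat-subst {V = V} {record { Vprop = λ p w → Sat _ V g w (onProp σ p)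
                               ; Vnom = λ i → ⟦ onNom σ i ⟧ V g }}
      σ g (λ _ → ⇔-id _) (λ _ → refl) φ (λ _ → refl) safe)
    (soundness d F∈ _ _ w)
  soundness (Nec-□ d) F∈ V g w v Rwv = soundness d F∈ V g v
  soundness (Nec-at i d) F∈ V g w = soundness d F∈ V g _
  soundness (Nec-↓ x d) F∈ V g w = soundness d F∈ V _ w

-- Derivations

-- Propositional reasoning is needed for theorems, for consequences of a theory, for what holds at a
-- nominal, for what holds at all successors of a nominal, and for consequences of `Γ`. All of these
-- contain the theorems and are closed under modus ponens, so one toolkit serves them all.
record Deductive (Σ C : Pred Form 0ℓ) : Set where
  field
    theorem : ∀ {φ} → Σ ⊢ φ → φ ∈ C
    mp      : ∀ {φ ψ} → φ ⇒ ψ ∈ C → φ ∈ C → ψ ∈ C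

theorems : ∀ {Σ} → Deductive Σ (Σ ⊢_)
theorems = record { theorem = id ; mp = MP }

module Propositional {Σ C : Pred Form 0ℓ} (deductive : Deductive Σ C) where
  open Deductive deductive public

  private
    tautology : ∀ {φ} → Tautology φ → φ ∈ C
    tautology t = theorem (ax (taut t))

  identity : ∀ {φ} → φ ⇒ φ ∈ C
  identity {φ} = tautology λ v → table (eval v φ)
    where
    table : ∀ a → not a ∨ a ≡ true
    table true  = refl
    table false = refl

  weaken : ∀ {φ ψ} → ψ ∈ C → φ ⇒ ψ ∈ C
  weaken {φ} {ψ} = mp (tautology λ v → table (eval v φ) (eval v ψ))
    where
    table : ∀ a b → not b ∨ (not a ∨ b) ≡ true
    table true  true  = refl
    table false true  = refl
    table a     false = refl

  distribute : ∀ {φ ψ χ} → φ ⇒ ψ ⇒ χ ∈ C → φ ⇒ ψ ∈ C → φ ⇒ χ ∈ C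
  distribute {φ} {ψ} {χ} d e =
    mp (mp (tautology λ v → table (eval v φ) (eval v ψ) (eval v χ)) d) e
    where
    table : ∀ a b c → not (not a ∨ (not b ∨ c)) ∨ (not (not a ∨ b) ∨ (not a ∨ c)) ≡ true
    table false b     c     = refl
    table true  false c     = refl
    table true  true  true  = refl
    table true  true  false = refl

  chain : ∀ {φ ψ χ} → φ ⇒ ψ ∈ C → ψ ⇒ χ ∈ C → φ ⇒ χ ∈ C
  chain d e = distribute (weaken e) d

  swap : ∀ {φ ψ χ} → φ ⇒ ψ ⇒ χ ∈ C → ψ ⇒ φ ⇒ χ ∈ C
  swap {φ} {ψ} {χ} = mp (tautology λ v → table (eval v φ) (eval v ψ) (eval v χ))
    where
    table : ∀ a b c → not (not a ∨ (not b ∨ c)) ∨ (not b ∨ (not a ∨ c)) ≡ true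
    table false true  c     = refl
    table false false c     = refl
    table true  false c     = refl
    table true  true  true  = refl
    table true  true  false = refl

  ∧-intro : ∀ {φ ψ} → φ ∈ C → ψ ∈ C → φ ∧′ ψ ∈ C
  ∧-intro {φ} {ψ} d e = mp (mp (tautology λ v → table (eval v φ) (eval v ψ)) d) e
    where
    table : ∀ a b → not a ∨ (not b ∨ (a ∧ b)) ≡ true
    table true  true  = refl
    table true  false = refl
    table false b     = refl

  ∧-left⇒ : ∀ {φ ψ} → φ ∧′ ψ ⇒ φ ∈ C
  ∧-left⇒ {φ} {ψ} = tautology λ v → table (eval v φ) (eval v ψ)
    where
    table : ∀ a b → not (a ∧ b) ∨ a ≡ true
    table true  true  = refl
    table true  false = refl
    table false b     = refl

  ∧-right⇒ : ∀ {φ ψ} → φ ∧′ ψ ⇒ ψ ∈ C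
  ∧-right⇒ {φ} {ψ} = tautology λ v → table (eval v φ) (eval v ψ)
    where
    table : ∀ a b → not (a ∧ b) ∨ b ≡ true
    table true  true  = refl
    table true  false = refl
    table false b     = refl

  ∧-elimˡ : ∀ {φ ψ} → φ ∧′ ψ ∈ C → φ ∈ C
  ∧-elimˡ = mp ∧-left⇒

  ∧-elimʳ : ∀ {φ ψ} → φ ∧′ ψ ∈ C → ψ ∈ C
  ∧-elimʳ = mp ∧-right⇒

  curry : ∀ {φ ψ χ} → φ ∧′ ψ ⇒ χ ∈ C → φ ⇒ ψ ⇒ χ ∈ C
  curry {φ} {ψ} {χ} = mp (tautology λ v → table (eval v φ) (eval v ψ) (eval v χ))
    where
    table : ∀ a b c → not (not (a ∧ b) ∨ c) ∨ (not a ∨ (not b ∨ c)) ≡ true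
    table false b     c     = refl
    table true  false c     = refl
    table true  true  true  = refl
    table true  true  false = refl

  ∨-introˡ : ∀ {φ ψ} → φ ∈ C → φ ∨′ ψ ∈ C
  ∨-introˡ {φ} {ψ} = mp (tautology λ v → table (eval v φ) (eval v ψ))
    where
    table : ∀ a b → not a ∨ (a ∨ b) ≡ true
    table true  b = refl
    table false b = refl

  ∨-introʳ : ∀ {φ ψ} → ψ ∈ C → φ ∨′ ψ ∈ C
  ∨-introʳ {φ} {ψ} = mp (tautology λ v → table (eval v φ) (eval v ψ))
    where
    table : ∀ a b → not b ∨ (a ∨ b) ≡ true
    table true  true  = refl
    table true  false = refl
    table false true  = refl
    table false false = refl

  ∨-elimʳ : ∀ {φ ψ} → φ ∨′ ψ ∈ C → ¬′ φ ∈ C → ψ ∈ C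
  ∨-elimʳ {φ} {ψ} d e = mp (mp (tautology λ v → table (eval v φ) (eval v ψ)) d) e
    where
    table : ∀ a b → not (a ∨ b) ∨ (not (not a) ∨ b) ≡ true
    table true  b     = refl
    table false true  = refl
    table false false = refl

  explosion : ∀ {φ ψ} → ¬′ φ ∈ C → φ ⇒ ψ ∈ C
  explosion {φ} {ψ} = mp (tautology λ v → table (eval v φ) (eval v ψ))
    where
    table : ∀ a b → not (not a) ∨ (not a ∨ b) ≡ true
    table true  b = refl
    table false b = refl

  ¬-intro : ∀ {φ} → φ ⇒ ⊥′ ∈ C → ¬′ φ ∈ C
  ¬-intro {φ} = mp (tautology λ v → table (eval v φ))
    where
    table : ∀ a → not (not a ∨ false) ∨ not a ≡ true
    table true  = refl
    table false = refl

  refute : ∀ {φ ψ χ} → φ ⇒ ψ ⇒ χ ⇒ ⊥′ ∈ C → χ ⇒ ψ ⇒ ¬′ φ ∈ C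
  refute {φ} {ψ} {χ} = mp (tautology λ v → table (eval v φ) (eval v ψ) (eval v χ))
    where
    table : ∀ a b c → not (not a ∨ (not b ∨ (not c ∨ false))) ∨ (not c ∨ (not b ∨ not a)) ≡ true
    table true  true  true  = refl
    table true  true  false = refl
    table true  false true  = refl
    table true  false false = refl
    table false true  true  = refl
    table false true  false = refl
    table false false true  = refl
    table false false false = refl

  contrapose : ∀ {φ ψ} → φ ⇒ ψ ∈ C → ¬′ ψ ⇒ ¬′ φ ∈ C
  contrapose {φ} {ψ} = mp (tautology λ v → table (eval v φ) (eval v ψ))
    where
    table : ∀ a b → not (not a ∨ b) ∨ (not (not b) ∨ not a) ≡ true
    table true  true  = refl
    table true  false = refl
    table false true  = refl
    table false false = refl

  ¬¬-elim⇒ : ∀ {φ} → ¬′ ¬′ φ ⇒ φ ∈ C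
  ¬¬-elim⇒ {φ} = tautology λ v → table (eval v φ)
    where
    table : ∀ a → not (not (not a)) ∨ a ≡ true
    table true  = refl
    table false = refl

  ¬¬-intro⇒ : ∀ {φ} → φ ⇒ ¬′ ¬′ φ ∈ C
  ¬¬-intro⇒ {φ} = tautology λ v → table (eval v φ)
    where
    table : ∀ a → not a ∨ not (not a) ≡ true
    table true  = refl
    table false = refl

  contrapose⁻¹ : ∀ {φ ψ} → ¬′ φ ⇒ ¬′ ψ ∈ C → ψ ⇒ φ ∈ C
  contrapose⁻¹ d = chain ¬¬-intro⇒ (chain (contrapose d) ¬¬-elim⇒)

  ¬-swapˡ : ∀ {φ ψ} → ¬′ φ ⇒ ψ ∈ C → ¬′ ψ ⇒ φ ∈ C
  ¬-swapˡ d = chain (contrapose d) ¬¬-elim⇒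

  ¬-swapʳ : ∀ {φ ψ} → φ ⇒ ¬′ ψ ∈ C → ψ ⇒ ¬′ φ ∈ C
  ¬-swapʳ d = chain ¬¬-intro⇒ (contrapose d)

infix 30 [_]_

pattern [_]_ i φ = at (nm i) φ

module _ {Σ : Pred Form 0ℓ} where
  open Propositional (theorems {Σ})

  private
    instantiate : Form → Form → Subst
    instantiate φ ψ = record
      { onProp = λ { 0 → φ ; (suc _) → ψ } ; onSvar = sv ; onNom = nm }

  □-K : ∀ φ ψ → Σ ⊢ □ (φ ⇒ ψ) ⇒ □ φ ⇒ □ ψ
  □-K φ ψ = SB (instantiate φ ψ) (([] , []) , [] , []) (ax (K 0 1))

  at-K : ∀ i φ ψ → Σ ⊢ [ i ] (φ ⇒ ψ) ⇒ [ i ] φ ⇒ [ i ] ψ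
  at-K i φ ψ = SB (instantiate φ ψ) (([] , [] , []) , ([] , []) , [] , []) (ax (K-at i 0 1))

  ◇-dual : ∀ φ → Σ ⊢ ◇ φ ⇔′ ¬′ □ ¬′ φ
  ◇-dual φ = SB (instantiate φ φ) (([] , []) , [] , []) (ax (dual 0))

  at-selfdual : ∀ i φ → Σ ⊢ ¬′ [ i ] φ ⇔′ [ i ] (¬′ φ)
  at-selfdual i φ = SB (instantiate φ φ)
    ((([] , []) , [] , []) , ([] , []) , [] , []) (ax (selfdual i 0))

  at-intro : ∀ i φ → Σ ⊢ tm (nm i) ⇒ φ ⇒ [ i ] φ
  at-intro i φ = curry (SB (instantiate φ φ) (([] , []) , [] , []) (ax (intro i 0)))

  at-back : ∀ i φ → Σ ⊢ ◇ [ i ] φ ⇒ [ i ] φ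
  at-back i φ = SB (instantiate φ φ) (([] , []) , [] , []) (ax (back i 0))

  at-agree : ∀ i j φ → Σ ⊢ [ i ] [ j ] φ ⇒ [ j ] φ
  at-agree i j φ = SB (instantiate φ φ) (([] , [] , []) , [] , []) (ax (agree i j 0))

  □-mono : ∀ {φ ψ} → Σ ⊢ φ ⇒ ψ → Σ ⊢ □ φ ⇒ □ ψ
  □-mono d = MP (□-K _ _) (Nec-□ d)

  at-mono : ∀ {φ ψ} i → Σ ⊢ φ ⇒ ψ → Σ ⊢ [ i ] φ ⇒ [ i ] ψ
  at-mono i d = MP (at-K i _ _) (Nec-at i d)

  ¬at⇒at¬ : ∀ i φ → Σ ⊢ ¬′ [ i ] φ ⇒ [ i ] (¬′ φ)
  ¬at⇒at¬ i φ = ∧-elimˡ (at-selfdual i φ)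

  at¬⇒¬at : ∀ i φ → Σ ⊢ [ i ] (¬′ φ) ⇒ ¬′ [ i ] φ
  at¬⇒¬at i φ = ∧-elimʳ (at-selfdual i φ)

  □¬⇒¬◇ : ∀ φ → Σ ⊢ □ (¬′ φ) ⇒ ¬′ ◇ φ
  □¬⇒¬◇ φ = ¬-swapʳ (∧-elimˡ (◇-dual φ))

  ¬□⇒◇¬ : ∀ φ → Σ ⊢ ¬′ □ φ ⇒ ◇ (¬′ φ)
  ¬□⇒◇¬ φ = chain (contrapose (□-mono ¬¬-elim⇒)) (∧-elimʳ (◇-dual (¬′ φ)))

  -- Back for `¬′ φ`, contraposed; Selfdual moves the negations across @.
  at⇒□at : ∀ i φ → Σ ⊢ [ i ] φ ⇒ □ [ i ] φ
  at⇒□at i φ = chain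
    (contrapose⁻¹ (chain (∧-elimʳ (◇-dual ([ i ] (¬′ φ)))) (chain (at-back i (¬′ φ)) (at¬⇒¬at i φ))))
    (□-mono (¬-swapˡ (¬at⇒at¬ i φ)))

  -- The converse of Agree: Agree for `¬′ φ`, contraposed, with Selfdual at both nominals.
  at⇒atat : ∀ i j φ → Σ ⊢ [ j ] φ ⇒ [ i ] [ j ] φ
  at⇒atat i j φ = contrapose⁻¹ (chain (¬at⇒at¬ i ([ j ] φ))
    (chain (at-mono i (¬at⇒at¬ j φ)) (chain (at-agree i j (¬′ φ)) (at¬⇒¬at j φ))))

  at-deductive : ∀ i → Deductive Σ (λ φ → Σ ⊢ [ i ] φ)
  at-deductive i = record { theorem = Nec-at i ; mp = λ d → MP (MP (at-K i _ _) d) }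

  -- Rename the fresh nominal to a fresh state variable y and apply Name-↓ to ↓y.@_y φ.
  name : ∀ j φ → ¬ NomIn j φ → Σ ⊢ [ j ] φ → Σ ⊢ φ
  name j φ j∉φ d = MP (ax (name-↓ y φ y∉φ)) (Nec-↓ y renamed)
    where
    y = proj₁ (OccursIn-bounded φ)
    y∉φ : ¬ OccursIn y φ
    y∉φ = proj₂ (OccursIn-bounded φ) ≤-refl

    σ : Subst
    σ = record { onProp = var ; onSvar = sv ; onNom = nm ⟨ j ≔ sv y ⟩ }

    fixes : ∀ i → NomIn i φ → onNom σ i ≡ nm i
    fixes i i∈φ = ≔-other nm λ { refl → j∉φ i∈φ }

    safe : Safe σ ([ j ] φ)
    safe = [] , closed-safe [] φ (λ _ ()) (λ { x refl → refl })
      (λ i i∈φ free → nm≢sv (trans (sym (fixes i i∈φ)) free))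
      where
      nm≢sv : ∀ {i x} → ¬ nm i ≡ sv x
      nm≢sv ()

    renamed : Σ ⊢ at (sv y) φ
    renamed = transport (Σ ⊢_)
      (cong₂ at (≔-same nm j) (subst-fixed {σ} φ (λ _ → refl) (λ _ _ → refl) fixes))
      (SB σ safe d)

-- T i φ says that the theory T contains [ i ] φ.
Theory : Set₁
Theory = Nom → Form → Set

FreshFor : Nom → Theory → Set
FreshFor j T = ∀ {i φ} → T i φ → ¬ NomIn j ([ i ] φ)

infix 4 _∣_⊢_

-- Necessitation and SB act only inside `thm`, never on hypotheses, so the deduction theorem holds
-- without side conditions.
data _∣_⊢_ (Σ : Pred Form 0ℓ) (T : Theory) : Form → Set where
  hyp : ∀ {i φ} → T i φ → Σ ∣ T ⊢ [ i ] φ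
  thm : ∀ {φ} → Σ ⊢ φ → Σ ∣ T ⊢ φ
  mp  : ∀ {φ ψ} → Σ ∣ T ⊢ φ ⇒ ψ → Σ ∣ T ⊢ φ → Σ ∣ T ⊢ ψ

infixl 5 _,[_,_]

_,[_,_] : Theory → Nom → Form → Theory
(T ,[ i , φ ]) k χ = T k χ ⊎ (k ≡ i × χ ≡ φ)

module _ {Σ : Pred Form 0ℓ} where
  private module ⊢ = Propositional (theorems {Σ})

  derivations : ∀ T → Deductive Σ (Σ ∣ T ⊢_)
  derivations T = record { theorem = thm ; mp = mp }

  derive-mono : ∀ {T T′ : Theory} {φ} → (∀ {i ψ} → T i ψ → T′ i ψ) → Σ ∣ T ⊢ φ → Σ ∣ T′ ⊢ φ
  derive-mono T⊆T′ (hyp h)  = hyp (T⊆T′ h)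
  derive-mono T⊆T′ (thm d)  = thm d
  derive-mono T⊆T′ (mp d e) = mp (derive-mono T⊆T′ d) (derive-mono T⊆T′ e)

  deduction : ∀ {T i φ ψ} → Σ ∣ T ,[ i , φ ] ⊢ ψ → Σ ∣ T ⊢ [ i ] φ ⇒ ψ
  deduction {T} (hyp (inj₁ h))             = weaken (hyp h)
    where open Propositional (derivations T)
  deduction {T} (hyp (inj₂ (refl , refl))) = identity
    where open Propositional (derivations T)
  deduction {T} (thm d)  = thm (⊢.weaken d)
  deduction {T} (mp d e) = distribute (deduction d) (deduction e)
    where open Propositional (derivations T)

  -- `name` applies to theorems only. Condensing the hypotheses used into one formula `δ` turns a
  -- derivation into a theorem, and the freshness clause keeps a fresh nominal out of it.
  compactness : ∀ {T φ} → Σ ∣ T ⊢ φ →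
    ∃[ δ ] (Σ ∣ T ⊢ δ) × (∀ {j} → FreshFor j T → ¬ NomIn j δ) × Σ ⊢ δ ⇒ φ
  compactness (hyp {i} {φ} h) = [ i ] φ , hyp h , (λ fresh → fresh h) , ⊢.identity
  compactness (thm d) = ⊤′ , thm (ax (taut λ _ → refl)) , (λ _ ()) , ⊢.weaken d
  compactness {T} (mp d e) with compactness d | compactness e
  ... | δ , dδ , δ-fresh , δ⇒ | ε , dε , ε-fresh , ε⇒ =
    δ ∧′ ε , Propositional.∧-intro (derivations T) dδ dε ,
    (λ fresh → [ δ-fresh fresh , ε-fresh fresh ]′) ,
    ⊢.distribute (⊢.chain ⊢.∧-left⇒ δ⇒) (⊢.chain ⊢.∧-right⇒ ε⇒)

  at□-deductive : ∀ T i → Deductive Σ (λ φ → Σ ∣ T ⊢ [ i ] □ φ)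
  at□-deductive T i = record
    { theorem = λ d → thm (Nec-at i (Nec-□ d))
    ; mp      = λ d → mp (mp (thm (at-K i _ _)) (mp (thm (at-mono i (□-K _ _))) d))
    }

  -- All hypotheses are @-formulas, so they hold at every point.
  derive-at□ : ∀ {T φ} i → Σ ∣ T ⊢ φ → Σ ∣ T ⊢ [ i ] □ φ
  derive-at□ i (hyp {k} {χ} h) = mp (thm (⊢.chain (at⇒atat i k χ) (at-mono i (at⇒□at k χ)))) (hyp h)
  derive-at□ {T} i (thm d)  = Deductive.theorem (at□-deductive T i) d
  derive-at□ {T} i (mp d e) = Deductive.mp (at□-deductive T i) (derive-at□ i d) (derive-at□ i e)

  -- The fresh nominal j is bound by ↓: every successor of i satisfies
  -- ↓x.@_i ◇ x by BG-↓, and DA at j turns this into @_i ◇ j.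
  paste : ∀ {T i j ψ} → FreshFor j T → ¬ NomIn j ψ → i ≢ j →
          Σ ∣ T ,[ i , ◇ tm (nm j) ] ,[ j , ψ ] ⊢ ⊥′ → Σ ∣ T ⊢ ¬′ [ i ] ◇ ψ
  paste {T} {i} {j} {ψ} j∉T j∉ψ i≢j inconsistent
    with compactness (deduction (deduction inconsistent))
  ... | δ , dδ , δ-fresh , δ⇒ =
    -- Every successor of `i` satisfies `seesI` by BG and `δ` because `δ` is derived from
    -- @-formulas, so it satisfies `¬′ ψ`.
    mp (thm (⊢.chain (at-mono i (□¬⇒¬◇ ψ)) (at¬⇒¬at i (◇ ψ))))
       (C.mp (C.¬-swapʳ (C.mp (C.theorem (name j _ j-fresh ψ⇒¬δ-atJ)) (thm (ax (BG-↓ i 0)))))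
             (derive-at□ i dδ))
    where
    seesI : Form
    seesI = ↓ 0 ([ i ] ◇ tm (sv 0))

    -- At `j`, Intro and Ref turn `ψ` into `[ j ] ψ`, and DA replaces `[ i ] ◇ tm (nm j)` by
    -- `seesI`. No occurrence of `j` is left inside the brackets, so `name` can drop the outer
    -- `[ j ]`.
    ψ⇒¬δ-atJ : Σ ⊢ [ j ] (seesI ⇒ ψ ⇒ ¬′ δ)
    ψ⇒¬δ-atJ = J.chain (J.∧-elimˡ (ax (DA j 0 ([ i ] ◇ tm (sv 0)))))
      (J.swap (J.chain (J.mp (Nec-at j (at-intro j ψ)) (ax (ref j)))
        (Nec-at j (⊢.refute δ⇒))))
      where module J = Propositional (at-deductive {Σ} j)

    j-fresh : ¬ NomIn j (seesI ⇒ ψ ⇒ ¬′ δ)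
    j-fresh (inj₁ (inj₁ refl))        = i≢j refl
    j-fresh (inj₂ (inj₁ j∈ψ))         = j∉ψ j∈ψ
    j-fresh (inj₂ (inj₂ j∈δ))         = δ-fresh j∉T j∈δ

    module C = Propositional (at□-deductive T i)

-- Maximal theories with witnesses

terms : ℕ → List Term
terms n = map sv (upTo n) ++ map nm (upTo n)

layers : ℕ → List Form → List (List Form)
layers n φs =
  (⊥′ ∷ ⊤′ ∷ []) ∷ map var (upTo n) ∷ map tm (terms n) ∷
  map ¬′_ φs ∷ map ◇_ φs ∷ map □_ φs ∷
  cartesianProductWith _∨′_ φs φs ∷ cartesianProductWith _∧′_ φs φs ∷
  cartesianProductWith _⇒_ φs φs ∷ cartesianProductWith at (terms n) φs ∷
  cartesianProductWith ↓ (upTo n) φs ∷ []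

forms : ℕ → List Form
forms zero    = []
forms (suc n) = concat (layers n (forms n))

-- Membership from some stage on, not merely at one stage, so that two components of a formula meet
-- at the larger of their stages.
EventuallyIn : ∀ {A : Set} → A → (ℕ → List A) → Set
EventuallyIn a as = ∃[ k ] ∀ {n} → k ≤ n → a ∈ₗ as n

upTo-eventually : ∀ m → EventuallyIn m upTo
upTo-eventually m = suc m , ∈-upTo⁺

terms-eventually : ∀ t → EventuallyIn t terms
terms-eventually (sv x) = suc x , λ x<n → ∈-++⁺ˡ (∈-map⁺ sv (∈-upTo⁺ x<n))
terms-eventually (nm i) = suc i , λ {n} i<n → ∈-++⁺ʳ (map sv (upTo n)) (∈-map⁺ nm (∈-upTo⁺ i<n))

InLayer : ℕ → Form → Set
InLayer n φ = ∃[ φs ] φ ∈ₗ φs × φs ∈ₗ layers n (forms n)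

next : ∀ {φ} k → (∀ {n} → k ≤ n → InLayer n φ) → EventuallyIn φ forms
next k layer = suc k , λ { {suc n} (s≤s k≤n) → let _ , φ∈ , ∈layers = layer k≤n in
  ∈-concat⁺′ {xss = layers n (forms n)} φ∈ ∈layers }

next₁ : ∀ {A : Set} {a : A} {as φ} → EventuallyIn a as →
        (∀ {n} → a ∈ₗ as n → InLayer n φ) → EventuallyIn φ forms
next₁ (k , a∈) layer = next k (layer ∘ a∈)

next₂ : ∀ {A B : Set} {a : A} {b : B} {as bs φ} → EventuallyIn a as → EventuallyIn b bs →
        (∀ {n} → a ∈ₗ as n → b ∈ₗ bs n → InLayer n φ) → EventuallyIn φ forms
next₂ (k , a∈) (l , b∈) layer = next (k ⊔ l) λ k⊔l≤n →
  layer (a∈ (≤-trans (m≤m⊔n k l) k⊔l≤n)) (b∈ (≤-trans (m≤n⊔m k l) k⊔l≤n))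

forms-eventually : ∀ φ → EventuallyIn φ forms
forms-eventually ⊥′       = next 0 λ _ → _ , here refl , here refl
forms-eventually ⊤′       = next 0 λ _ → _ , there (here refl) , here refl
forms-eventually (var p)  = next₁ (upTo-eventually p) λ p∈ →
  _ , ∈-map⁺ var p∈ , there (here refl)
forms-eventually (tm t)   = next₁ (terms-eventually t) λ t∈ →
  _ , ∈-map⁺ tm t∈ , there (there (here refl))
forms-eventually (¬′ φ)   = next₁ (forms-eventually φ) λ φ∈ →
  _ , ∈-map⁺ ¬′_ φ∈ , there (there (there (here refl)))
forms-eventually (◇ φ)    = next₁ (forms-eventually φ) λ φ∈ →
  _ , ∈-map⁺ ◇_ φ∈ , there (there (there (there (here refl))))
forms-eventually (□ φ)    = next₁ (forms-eventually φ) λ φ∈ →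
  _ , ∈-map⁺ □_ φ∈ , there (there (there (there (there (here refl)))))
forms-eventually (φ ∨′ ψ) = next₂ (forms-eventually φ) (forms-eventually ψ) λ φ∈ ψ∈ →
  _ , ∈-cartesianProductWith⁺ _∨′_ φ∈ ψ∈ ,
    there (there (there (there (there (there (here refl))))))
forms-eventually (φ ∧′ ψ) = next₂ (forms-eventually φ) (forms-eventually ψ) λ φ∈ ψ∈ →
  _ , ∈-cartesianProductWith⁺ _∧′_ φ∈ ψ∈ ,
    there (there (there (there (there (there (there (here refl)))))))
forms-eventually (φ ⇒ ψ)  = next₂ (forms-eventually φ) (forms-eventually ψ) λ φ∈ ψ∈ →
  _ , ∈-cartesianProductWith⁺ _⇒_ φ∈ ψ∈ ,
    there (there (there (there (there (there (there (there (here refl))))))))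
forms-eventually (at t φ) = next₂ (terms-eventually t) (forms-eventually φ) λ t∈ φ∈ →
  _ , ∈-cartesianProductWith⁺ at t∈ φ∈ ,
    there (there (there (there (there (there (there (there (there (here refl)))))))))
forms-eventually (↓ x φ)  = next₂ (upTo-eventually x) (forms-eventually φ) λ x∈ φ∈ →
  _ , ∈-cartesianProductWith⁺ ↓ x∈ φ∈ ,
    there (there (there (there (there (there (there (there (there (there (here refl))))))))))

-- Nominals are split into three infinite classes: copies of the nominals,
-- copies of the state variables, and spare ones.
data Tag : Set where
  nominal svar spare : Tag

code : Tag → ℕ → Nom
code nominal zero    = 0
code svar    zero    = 1
code spare   zero    = 2
code t       (suc n) = suc (suc (suc (code t n)))

decode : Nom → Tag × ℕ
decode 0 = nominal , 0
decode 1 = svar , 0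
decode 2 = spare , 0
decode (suc (suc (suc n))) = map₂ suc (decode n)

decode-code : ∀ t n → decode (code t n) ≡ (t , n)
decode-code nominal zero    = refl
decode-code svar    zero    = refl
decode-code spare   zero    = refl
decode-code nominal (suc n) = cong (map₂ suc) (decode-code nominal n)
decode-code svar    (suc n) = cong (map₂ suc) (decode-code svar n)
decode-code spare   (suc n) = cong (map₂ suc) (decode-code spare n)

code-injective : ∀ {s t m n} → code s m ≡ code t n → (s , m) ≡ (t , n)
code-injective {s} {t} {m} {n} eq =
  trans (sym (decode-code s m)) (trans (cong decode eq) (decode-code t n))

fresh : ℕ → Nom
fresh = code spare

n≤fresh : ∀ n → n ≤ fresh n
n≤fresh zero    = z≤n
n≤fresh (suc n) = s≤s (≤-trans (n≤fresh n) (m≤n+m (fresh n) 2))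

-- `Γ` may mention every nominal, leaving none for witnesses; the copy vacates the spare ones. It
-- also makes formulas closed, so that the assignment is carried by nominals.
closeTerms : Subst
closeTerms = record { onProp = var ; onSvar = nm ∘ code svar ; onNom = nm ∘ code nominal }

reopenNom : Tag × ℕ → Term
reopenNom (svar    , x) = sv x
reopenNom (nominal , i) = nm i
-- An arbitrary value: no spare nominal occurs in a copied formula.
reopenNom (spare   , n) = nm n

reopenTerms : Subst
reopenTerms = record { onProp = var ; onSvar = sv ; onNom = reopenNom ∘ decode }

reopen-close : ∀ φ → subst reopenTerms (subst closeTerms φ) ≡ φ
reopen-close φ = trans
  (subst-composite {ρ = idSubst} φ record
    { propClosed = λ _ ()
    ; ownSvar    = λ _ ()
    ; nomClosed  = λ _ ()
    ; props      = λ _ → refl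
    ; svars      = λ x → cong reopenNom (decode-code svar x)
    ; noms       = λ i → cong reopenNom (decode-code nominal i)
    })
  (subst-id φ (λ _ → refl) (λ _ → refl) (λ _ → refl))

-- A copy of x occurs only where x was free, hence not in the scope of ↓x.
record ClosesBelow (B : List Svar) (τ : Subst) : Set where
  field
    props   : ∀ p → onProp τ p ≡ var p
    noms    : ∀ i → onNom τ i ≡ nm (code nominal i)
    bound   : ∀ x → x ∈ₗ B → onSvar τ x ≡ sv x
    unbound : ∀ x → x ∉ₗ B → onSvar τ x ≡ nm (code svar x)

closesBelow-binder : ∀ {B τ} y → ClosesBelow B τ → ClosesBelow (y ∷ B) (τ [ y ↦ sv y ])
closesBelow-binder {B} {τ} y closes = record
  { props   = props
  ; noms    = noms
  ; bound   = ≔-elim (λ x t → x ∈ₗ y ∷ B → t ≡ sv x) (onSvar τ) y (λ _ → refl)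
                (λ { x x≢y (here x≡y) → contradiction x≡y x≢y ; x x≢y (there x∈B) → bound x x∈B })
  ; unbound = λ x x∉ → trans (≔-other (onSvar τ) (x∉ ∘ here)) (unbound x (x∉ ∘ there))
  }
  where open ClosesBelow closes

reopen-safeTerm : ∀ {B τ} t → ClosesBelow B τ → SafeTermUnder B reopenTerms (substTerm τ t)
reopen-safeTerm {B} (nm i) closes
  rewrite ClosesBelow.noms closes i | decode-code nominal i = all-absent λ ()
reopen-safeTerm {B} (sv x) closes with _∈?_ _≟_ x B
... | yes x∈B rewrite ClosesBelow.bound closes x x∈B = inj₁ x∈B
... | no x∉B rewrite ClosesBelow.unbound closes x x∉B | decode-code svar x =
  tabulate λ { x∈B refl → x∉B x∈B }

reopen-safe : ∀ {B τ} φ → ClosesBelow B τ → SafeUnder B reopenTerms (subst τ φ)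
reopen-safe (var p)  closes rewrite ClosesBelow.props closes p = all-absent λ ()
reopen-safe (tm t)   closes = reopen-safeTerm t closes
reopen-safe ⊥′       closes = tt
reopen-safe ⊤′       closes = tt
reopen-safe (¬′ φ)   closes = reopen-safe φ closes
reopen-safe (φ ∨′ ψ) closes = reopen-safe φ closes , reopen-safe ψ closes
reopen-safe (φ ∧′ ψ) closes = reopen-safe φ closes , reopen-safe ψ closes
reopen-safe (φ ⇒ ψ)  closes = reopen-safe φ closes , reopen-safe ψ closes
reopen-safe (◇ φ)    closes = reopen-safe φ closes
reopen-safe (□ φ)    closes = reopen-safe φ closes
reopen-safe (at t φ) closes = reopen-safeTerm t closes , reopen-safe φ closes
reopen-safe (↓ y φ)  closes = reopen-safe φ (closesBelow-binder y closes)

-- The copy is undone by a safe substitution, so SB leads back to `φ`.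
closeTerms-reflects : ∀ {Σ} φ → Σ ⊢ subst closeTerms φ → Σ ⊢ φ
closeTerms-reflects {Σ} φ d = transport (Σ ⊢_) (reopen-close φ)
  (SB reopenTerms (reopen-safe φ record
    { props = λ _ → refl ; noms = λ _ → refl ; bound = λ _ () ; unbound = λ _ _ → refl }) d)

module _ {j : Nom} where

  NomIn-subst⁻ : ∀ τ φ → (∀ p → ¬ NomIn j (onProp τ p)) → (∀ x → onSvar τ x ≢ nm j) →
                 (∀ i → onNom τ i ≢ nm j) → ¬ NomIn j (subst τ φ)
  NomIn-subst⁻ τ (var p)       ps svs nms = ps p
  NomIn-subst⁻ τ (tm (sv x))   ps svs nms = svs x
  NomIn-subst⁻ τ (tm (nm i))   ps svs nms = nms i
  NomIn-subst⁻ τ ⊥′            ps svs nms = λ ()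
  NomIn-subst⁻ τ ⊤′            ps svs nms = λ ()
  NomIn-subst⁻ τ (¬′ φ)        ps svs nms = NomIn-subst⁻ τ φ ps svs nms
  NomIn-subst⁻ τ (φ ∨′ ψ)      ps svs nms =
    [ NomIn-subst⁻ τ φ ps svs nms , NomIn-subst⁻ τ ψ ps svs nms ]′
  NomIn-subst⁻ τ (φ ∧′ ψ)      ps svs nms =
    [ NomIn-subst⁻ τ φ ps svs nms , NomIn-subst⁻ τ ψ ps svs nms ]′
  NomIn-subst⁻ τ (φ ⇒ ψ)       ps svs nms =
    [ NomIn-subst⁻ τ φ ps svs nms , NomIn-subst⁻ τ ψ ps svs nms ]′
  NomIn-subst⁻ τ (◇ φ)         ps svs nms = NomIn-subst⁻ τ φ ps svs nms
  NomIn-subst⁻ τ (□ φ)         ps svs nms = NomIn-subst⁻ τ φ ps svs nms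
  NomIn-subst⁻ τ (at (sv x) φ) ps svs nms = [ svs x , NomIn-subst⁻ τ φ ps svs nms ]′
  NomIn-subst⁻ τ (at (nm i) φ) ps svs nms = [ nms i , NomIn-subst⁻ τ φ ps svs nms ]′
  NomIn-subst⁻ τ (↓ y φ)       ps svs nms = NomIn-subst⁻ (τ [ y ↦ sv y ]) φ ps
    (≔-elim (λ _ t → t ≢ nm j) (onSvar τ) y (λ ()) (λ x _ → svs x)) nms

nm-injective : ∀ {i j} → nm i ≡ nm j → i ≡ j
nm-injective refl = refl

fresh∉close : ∀ m φ → ¬ NomIn (fresh m) (subst closeTerms φ)
fresh∉close m φ = NomIn-subst⁻ closeTerms φ (λ _ ())
  (λ x eq → tags (code-injective {svar} {spare} {x} {m} (nm-injective eq)))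
  (λ i eq → tags′ (code-injective {nominal} {spare} {i} {m} (nm-injective eq)))
  where
  tags : ∀ {m n} → _≢_ {A = Tag × ℕ} (svar , m) (spare , n)
  tags ()
  tags′ : ∀ {m n} → _≢_ {A = Tag × ℕ} (nominal , m) (spare , n)
  tags′ ()

⊢[]-deductive : ∀ Σ Γ → Deductive Σ (Γ ⊢[ Σ ]_)
⊢[]-deductive Σ Γ = record
  { theorem = λ d → [] , [] , weaken d
  ; mp      = λ { (γs , γs∈ , d) (δs , δs∈ , e) →
                γs ++ δs , ++⁺ γs∈ δs∈ , distribute (chain (⋀-++ˡ γs δs) d) (chain (⋀-++ʳ γs δs) e) }
  }
  where
  open Propositional (theorems {Σ})
  ⋀-++ˡ : ∀ γs δs → Σ ⊢ ⋀ (γs ++ δs) ⇒ ⋀ γs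
  ⋀-++ˡ []       δs = weaken (ax (taut λ _ → refl))
  ⋀-++ˡ (γ ∷ γs) δs = distribute (chain ∧-left⇒ (curry identity)) (chain ∧-right⇒ (⋀-++ˡ γs δs))
  ⋀-++ʳ : ∀ γs δs → Σ ⊢ ⋀ (γs ++ δs) ⇒ ⋀ δs
  ⋀-++ʳ []       δs = identity
  ⋀-++ʳ (γ ∷ γs) δs = chain ∧-right⇒ (⋀-++ʳ γs δs)

-- The theory of a refutation and its consistency

module _ {Σ : Pred Form 0ℓ} where

  -- `fresh 0` names the point where `Γ` is to hold and `γ` to fail. Being spare it occurs in no
  -- copied formula, so `name` can later remove it.
  refutation : Pred Form 0ℓ → Form → Theory
  refutation Γ γ i φ = i ≡ fresh 0 × ∃[ δ ] (δ ∈ Γ ⊎ δ ≡ ¬′ γ) × φ ≡ subst closeTerms δ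

  -- All hypotheses sit at the same nominal, so those used can be conjoined before copying; `δ` is
  -- that conjunction. The hypothesis `¬′ γ` is discharged, which leaves only members of `Γ`.
  refutation-theorem : ∀ {Γ γ φ} → Σ ∣ refutation Γ γ ⊢ φ →
    ∃[ δ ] (Γ ⊢[ Σ ] ¬′ γ ⇒ δ) × Σ ⊢ [ fresh 0 ] (subst closeTerms δ) ⇒ φ
  refutation-theorem {Γ} (hyp (refl , δ , inj₁ δ∈Γ , refl)) =
    δ , Propositional.weaken (⊢[]-deductive Σ Γ)
          (δ ∷ [] , δ∈Γ ∷ [] , Propositional.∧-left⇒ (theorems {Σ})) ,
    Propositional.identity (theorems {Σ})
  refutation-theorem {Γ} (hyp (refl , δ , inj₂ refl , refl)) =
    δ , Propositional.identity (⊢[]-deductive Σ Γ) , Propositional.identity (theorems {Σ})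
  refutation-theorem {Γ} (thm d) =
    ⊤′ , Propositional.weaken (⊢[]-deductive Σ Γ)
           (Deductive.theorem (⊢[]-deductive Σ Γ) (ax (taut λ _ → refl))) ,
    Propositional.weaken (theorems {Σ}) d
  refutation-theorem {Γ} (mp d e) with refutation-theorem d | refutation-theorem e
  ... | δ , Γδ , δ⇒ | ε , Γε , ε⇒ =
    δ ∧′ ε ,
    Γ⊢.distribute (Γ⊢.chain Γδ (Γ⊢.curry Γ⊢.identity)) Γε ,
    ⊢.distribute (⊢.chain (at-mono (fresh 0) ⊢.∧-left⇒) δ⇒)
                 (⊢.chain (at-mono (fresh 0) ⊢.∧-right⇒) ε⇒)
    where
    module ⊢ = Propositional (theorems {Σ})
    module Γ⊢ = Propositional (⊢[]-deductive Σ Γ)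

  refutation-consistent : ∀ {Γ γ} → ¬ Γ ⊢[ Σ ] γ → ¬ Σ ∣ refutation Γ γ ⊢ ⊥′
  refutation-consistent {Γ} {γ} Γ⊬γ inconsistent with refutation-theorem inconsistent
  ... | δ , Γδ , δ⇒⊥ = Γ⊬γ (Γ⊢.mp (Γ⊢.¬-swapˡ Γδ) (Γ⊢.theorem ⊢¬δ))
    where
    module ⊢ = Propositional (theorems {Σ})
    module Γ⊢ = Propositional (⊢[]-deductive Σ Γ)
    ⊢¬δ : Σ ⊢ ¬′ δ
    ⊢¬δ = closeTerms-reflects (¬′ δ) (name (fresh 0) _ (fresh∉close 0 (¬′ δ))
      (MP (¬at⇒at¬ (fresh 0) _) (⊢.¬-intro δ⇒⊥)))

  -- Both alternatives persist when the theory grows, so settling a formula at one stage settles it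
  -- in the limit. The refuted case asks for derivability only, which spares adding the negation.
  Decided : Theory → Nom → Form → Set
  Decided T i φ = Σ ∣ T ⊢ ¬′ [ i ] φ ⊎
    (T i φ × (∀ {ψ} → φ ≡ ◇ ψ → ∃[ j ] T i (◇ tm (nm j)) × T j ψ))

  record Henkin (T : Theory) : Set where
    field
      consistent : ¬ Σ ∣ T ⊢ ⊥′
      decided    : ∀ i φ → Decided T i φ

  infix 4 _⊆ᵗ_
  _⊆ᵗ_ : Theory → Theory → Set
  T ⊆ᵗ T′ = ∀ {i φ} → T i φ → T′ i φ

  decided-mono : ∀ {T T′ i φ} → T ⊆ᵗ T′ → Decided T i φ → Decided T′ i φ
  decided-mono T⊆ (inj₁ d)             = inj₁ (derive-mono T⊆ d)
  decided-mono T⊆ (inj₂ (h , witness)) =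
    inj₂ (T⊆ h , λ eq → let j , seesJ , ψ-atJ = witness eq in j , T⊆ seesJ , T⊆ ψ-atJ)

  -- The Lindenbaum construction in stages

  record Stage : Set₁ where
    field
      theory     : Theory
      consistent : ¬ Σ ∣ theory ⊢ ⊥′
      used       : ℕ
      unused     : ∀ {m} → used ≤ m → FreshFor (fresh m) theory
  open Stage

  addFormula : ∀ s i φ → ¬ Σ ∣ theory s ⊢ ¬′ [ i ] φ → Stage
  addFormula s i φ irrefutable = record
    { theory     = theory s ,[ i , φ ]
    ; consistent = λ inconsistent → irrefutable
        (Propositional.¬-intro (derivations (theory s)) (deduction inconsistent))
    -- `k` bounds the nominals of the new formula; from `k` on the spare nominals avoid it too,
    -- since `fresh m` is at least `m`.
    ; used       = used s ⊔ k
    ; unused     = λ {m} used⊔k≤m → λ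
        { (inj₁ h)             → unused s (≤-trans (m≤m⊔n (used s) k) used⊔k≤m) h
        ; (inj₂ (refl , refl)) →
            bounds (≤-trans (≤-trans (m≤n⊔m (used s) k) used⊔k≤m) (n≤fresh m)) }
    }
    where
    k = proj₁ (NomIn-bounded ([ i ] φ))
    bounds = proj₂ (NomIn-bounded ([ i ] φ))

  addWitness : ∀ s i ψ → theory s i (◇ ψ) → Stage
  addWitness s i ψ h = record
    { theory     = theory s ,[ i , ◇ tm (nm j) ] ,[ j , ψ ]
    ; consistent = λ inconsistent → consistent s
        (mp (Propositional.explosion (derivations (theory s))
              (paste (unused s ≤-refl) (j∉ ∘ inj₂) (λ { refl → j∉ (inj₁ refl) }) inconsistent))
            (hyp h))
    ; used       = suc (used s)
    ; unused     = later
    }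
    where
    j = fresh (used s)
    j∉ : ¬ NomIn j ([ i ] ◇ ψ)
    j∉ = unused s ≤-refl h

    later : ∀ {m} → suc (used s) ≤ m → FreshFor (fresh m) (theory s ,[ i , ◇ tm (nm j) ] ,[ j , ψ ])
    later {m} used<m = λ
      { (inj₁ (inj₁ h′))                          → m∉ h′
      ; (inj₁ (inj₂ (refl , refl))) (inj₁ i≡)     → m∉ h (inj₁ i≡)
      ; (inj₁ (inj₂ (refl , refl))) (inj₂ j≡)     → m≢used j≡
      ; (inj₂ (refl , refl))        (inj₁ j≡)     → m≢used j≡
      ; (inj₂ (refl , refl))        (inj₂ ∈ψ)     → m∉ h (inj₂ ∈ψ)
      }
      where
      m∉ : FreshFor (fresh m) (theory s)
      m∉ = unused s (≤-trans (n≤1+n _) used<m)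
      m≢used : nm j ≢ nm (fresh m)
      m≢used eq with code-injective {spare} {spare} {used s} {m} (nm-injective eq)
      ... | refl = <-irrefl refl used<m

  module _ (em : ExcludedMiddle 0ℓ) where

    decide : ∀ s i φ → ∃[ s′ ] theory s ⊆ᵗ theory s′ × Decided (theory s′) i φ
    decide s i φ with em {Σ ∣ theory s ⊢ ¬′ [ i ] φ} | em {∃[ ψ ] φ ≡ ◇ ψ}
    ... | yes refuted | _ = s , id , inj₁ refuted
    ... | no irrefutable | no not◇ =
      addFormula s i φ irrefutable , inj₁ ,
      inj₂ (inj₂ (refl , refl) , λ eq → contradiction (_ , eq) not◇)
    ... | no irrefutable | yes (ψ , refl) =
      addWitness (addFormula s i φ irrefutable) i ψ (inj₂ (refl , refl)) ,
      inj₁ ∘ inj₁ ∘ inj₁ ,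
      inj₂ (inj₁ (inj₁ (inj₂ (refl , refl))) ,
            λ { refl → _ , inj₁ (inj₂ (refl , refl)) , inj₂ (refl , refl) })

    decideAll : ∀ s χs → ∃[ s′ ] theory s ⊆ᵗ theory s′ ×
                (∀ {i φ} → [ i ] φ ∈ₗ χs → Decided (theory s′) i φ)
    decideAll s [] = s , id , λ ()
    decideAll s (χ ∷ χs) with decideAll s χs | em {∃[ i ] ∃[ φ ] χ ≡ [ i ] φ}
    ... | s′ , s⊆s′ , decided | no notAt =
      s′ , s⊆s′ , λ { (here refl) → contradiction (_ , _ , refl) notAt ; (there ∈χs) → decided ∈χs }
    ... | s′ , s⊆s′ , decided | yes (i , φ , refl) with decide s′ i φ
    ...   | s″ , s′⊆s″ , decided-φ =
      s″ , s′⊆s″ ∘ s⊆s′ ,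
      λ { (here refl) → decided-φ ; (there ∈χs) → decided-mono s′⊆s″ (decided ∈χs) }

    module _ (start : Stage) where

      stage : ℕ → Stage
      stage zero    = start
      stage (suc n) = proj₁ (decideAll (stage n) (forms n))

      stage-mono′ : ∀ {m n} → m ≤′ n → theory (stage m) ⊆ᵗ theory (stage n)
      stage-mono′ ≤′-refl = id
      stage-mono′ (≤′-step {n} m≤n) =
        proj₁ (proj₂ (decideAll (stage n) (forms n))) ∘ stage-mono′ m≤n

      stage-mono : ∀ {m n} → m ≤ n → theory (stage m) ⊆ᵗ theory (stage n)
      stage-mono = stage-mono′ ∘ ≤⇒≤′

      limit : Theory
      limit i φ = ∃[ n ] theory (stage n) i φ

      limit-derive : ∀ {φ} → Σ ∣ limit ⊢ φ → ∃[ n ] Σ ∣ theory (stage n) ⊢ φ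
      limit-derive (hyp (n , h)) = n , hyp h
      limit-derive (thm d)       = 0 , thm d
      limit-derive (mp d e) with limit-derive d | limit-derive e
      ... | m , d′ | n , e′ = m ⊔ n ,
        mp (derive-mono (stage-mono (m≤m⊔n m n)) d′) (derive-mono (stage-mono (m≤n⊔m m n)) e′)

      limit-henkin : Henkin limit
      limit-henkin = record
        { consistent = λ inconsistent →
            let n , d = limit-derive inconsistent in consistent (stage n) d
        ; decided    = λ i φ → let n , φ∈ = forms-eventually ([ i ] φ) in
            decided-mono (suc n ,_) (proj₂ (proj₂ (decideAll (stage n) (forms n))) (φ∈ ≤-refl))
        }

-- The canonical model

-- The second argument is fuel and also the answer when nothing smaller is found; it is then
-- returned untested, which is correct when it is known to satisfy `P`.
least : ∀ {P : ℕ → Set} → (∀ n → Dec (P n)) → ℕ → ℕ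
least P? zero = zero
least P? (suc n) with P? 0
... | yes _ = zero
... | no _  = suc (least (P? ∘ suc) n)

least-satisfies : ∀ {P : ℕ → Set} (P? : ∀ n → Dec (P n)) {n} → P n → P (least P? n)
least-satisfies P? {zero} Pn = Pn
least-satisfies P? {suc n} Pn with P? 0
... | yes P0 = P0
... | no _   = least-satisfies (P? ∘ suc) Pn

least-minimal : ∀ {P : ℕ → Set} (P? : ∀ n → Dec (P n)) n {m} → P m → least P? n ≤ m
least-minimal P? zero Pm = z≤n
least-minimal P? (suc n) {m} Pm with P? 0
least-minimal P? (suc n) {m}     Pm | yes _  = z≤n
least-minimal P? (suc n) {zero}  Pm | no ¬P0 = contradiction Pm ¬P0
least-minimal P? (suc n) {suc m} Pm | no _   = s≤s (least-minimal (P? ∘ suc) n Pm)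

module Canonical (em : ExcludedMiddle 0ℓ) {Σ : Pred Form 0ℓ} {T : Theory}
                 (henkin : Henkin {Σ} T) where
  open Henkin henkin
  private module ⊢ = Propositional (theorems {Σ})

  True : Nom → Pred Form 0ℓ
  True i φ = Σ ∣ T ⊢ at (nm i) φ

  true-deductive : ∀ i → Deductive Σ (True i)
  true-deductive i = record
    { theorem = λ d → thm (Nec-at i d) ; mp = λ d → mp (mp (thm (at-K i _ _)) d) }

  module At (i : Nom) = Propositional (true-deductive i)

  true-or-false : ∀ i φ → True i φ ⊎ True i (¬′ φ)
  true-or-false i φ with decided i φ
  ... | inj₁ d       = inj₂ (mp (thm (¬at⇒at¬ i φ)) d)
  ... | inj₂ (h , _) = inj₁ (hyp h)

  not-both : ∀ {i φ} → True i φ → ¬ True i (¬′ φ)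
  not-both {i} {φ} d e = consistent
    (mp (Propositional.explosion (derivations T) (mp (thm (at¬⇒¬at i φ)) e)) d)

  true-¬ : ∀ {i φ} → (¬ True i φ) ⇔ True i (¬′ φ)
  true-¬ {i} {φ} = mk⇔ (λ ¬d → [ (λ d → contradiction d ¬d) , id ]′ (true-or-false i φ))
                       (λ e d → not-both d e)

  true-∨ : ∀ {i φ ψ} → (True i φ ⊎ True i ψ) ⇔ True i (φ ∨′ ψ)
  true-∨ {i} {φ} = mk⇔ [ At.∨-introˡ i , At.∨-introʳ i ]′
    (λ d → Sum.map₂ (At.∨-elimʳ i d) (true-or-false i φ))

  true-∧ : ∀ {i φ ψ} → (True i φ × True i ψ) ⇔ True i (φ ∧′ ψ)
  true-∧ {i} = mk⇔ (λ (d , e) → At.∧-intro i d e) (λ d → At.∧-elimˡ i d , At.∧-elimʳ i d)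

  true-⇒ : ∀ {i φ ψ} → (True i φ → True i ψ) ⇔ True i (φ ⇒ ψ)
  true-⇒ {i} {φ} = mk⇔
    (λ f → [ At.weaken i ∘ f , At.explosion i ]′ (true-or-false i φ)) (At.mp i)

  true-at : ∀ {i j φ} → True j φ ⇔ True i (at (nm j) φ)
  true-at {i} {j} {φ} = mk⇔ (mp (thm (at⇒atat i j φ))) (mp (thm (at-agree i j φ)))

  true-transfer : ∀ {i j φ} → True i (tm (nm j)) → True i φ → True j φ
  true-transfer {i} {j} {φ} i≈j d =
    from true-at (At.mp i (At.mp i (thm (Nec-at i (at-intro j φ))) i≈j) d)

  true-ref : ∀ i → True i (tm (nm i))
  true-ref i = thm (ax (ref i))

  true-sym : ∀ {i j} → True i (tm (nm j)) → True j (tm (nm i))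
  true-sym i≈j = true-transfer i≈j (true-ref _)

  -- Suppose `¬′ φ` held at `j`. Then `[ j ] (¬′ φ)` would hold at every successor of `i`. A
  -- successor satisfying `φ` and `tm (nm j)` would give `[ j ] φ` by Intro, so no successor could
  -- be `j`.
  true-□ : ∀ {i j φ} → True i (□ φ) → True i (◇ tm (nm j)) → True j φ
  true-□ {i} {j} {φ} □φ ◇j with true-or-false j φ
  ... | inj₁ d  = d
  ... | inj₂ ¬φ = contradiction (At.mp i (At.theorem i (□¬⇒¬◇ _)) □¬j) (not-both ◇j)
    where
    module C = Propositional (at□-deductive {Σ} T i)
    □¬j : True i (□ (¬′ tm (nm j)))
    □¬j = C.mp (C.contrapose (C.mp (C.swap (C.theorem (at-intro j φ))) □φ))
               (C.mp (C.theorem (at¬⇒¬at j φ)) (derive-at□ i ¬φ))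

  true-◇ : ∀ {i j φ} → True i (◇ tm (nm j)) → True j φ → True i (◇ φ)
  true-◇ {i} {j} {φ} ◇j d with true-or-false i (◇ φ)
  ... | inj₁ ◇φ  = ◇φ
  ... | inj₂ ¬◇φ = contradiction
    (true-□ (At.mp i (At.¬-swapˡ i (At.∧-elimʳ i (At.theorem i (◇-dual φ)))) ¬◇φ) ◇j) (not-both d)

  ◇-witness : ∀ {i φ} → True i (◇ φ) → ∃[ j ] True i (◇ tm (nm j)) × True j φ
  ◇-witness {i} {φ} d with decided i (◇ φ)
  ... | inj₁ ¬d = contradiction
    (mp (Propositional.explosion (derivations T) ¬d) d) consistent
  ... | inj₂ (_ , witness) = let j , seesJ , φ-atJ = witness refl in j , hyp seesJ , hyp φ-atJ

  -- Worlds are nominals modulo equality in the theory, but `Sat` compares points by propositional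
  -- equality. Taking the least nominal of each class avoids a quotient.
  rep : Nom → Nom
  rep i = least (λ j → em {True i (tm (nm j))}) i

  rep-≈ : ∀ i → True i (tm (nm (rep i)))
  rep-≈ i = least-satisfies (λ j → em {True i (tm (nm j))}) (true-ref i)

  true-rep : ∀ i {φ} → True (rep i) φ ⇔ True i φ
  true-rep i = mk⇔ (true-transfer (true-sym (rep-≈ i))) (true-transfer (rep-≈ i))

  rep-≤ : ∀ {i j} → True i (tm (nm j)) → rep i ≤ rep j
  rep-≤ {i} {j} i≈j = least-minimal (λ k → em {True i (tm (nm k))}) i
    (true-transfer (true-sym i≈j) (rep-≈ j))

  rep-cong : ∀ {i j} → True i (tm (nm j)) → rep i ≡ rep j
  rep-cong i≈j = ≤-antisym (rep-≤ i≈j) (rep-≤ (true-sym i≈j))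

  World : Set
  World = Σ[ i ∈ Nom ] rep i ≡ i

  ⌊_⌋ : Nom → World
  ⌊ i ⌋ = rep i , sym (rep-cong (rep-≈ i))

  world-≡ : ∀ {u v : World} → proj₁ u ≡ proj₁ v → u ≡ v
  world-≡ {i , p} {.i , q} refl = cong (i ,_) (≡-irrelevant p q)

  ⌊⌋-proj₁ : ∀ u → ⌊ proj₁ u ⌋ ≡ u
  ⌊⌋-proj₁ (i , rep-i) = world-≡ rep-i

  ⌊⌋-≡ : ∀ {i} {w : World} → (⌊ i ⌋ ≡ w) ⇔ True (proj₁ w) (tm (nm i))
  ⌊⌋-≡ {i} {w} = mk⇔ (λ { refl → true-sym (rep-≈ i) })
    (λ d → world-≡ (trans (rep-cong (true-sym d)) (proj₂ w)))

  canonical : Frame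
  canonical = record
    { W        = World
    ; R        = λ u v → True (proj₁ u) (◇ tm (nm (proj₁ v)))
    ; nonempty = ⌊ 0 ⌋
    }

  -- Used twice: with the copying of terms, for the countermodel, and with formulas defining
  -- shrunken extensions, for frame validity. `N` is separate from `b` so that the nominals can be
  -- interpreted by a given `Vnom V` on the nose, although it agrees with the classes of `b` only up
  -- to a proof.
  module Grounding (θ : PropVar → Form) (b : Nom → Nom) (θ-closed : ∀ p {y} → ¬ FreeIn y (θ p))
           (N : Nom → World) (N≡b : ∀ i → N i ≡ ⌊ b i ⌋) where

    ground : (Svar → Nom) → Subst
    ground a = record { onProp = θ ; onSvar = nm ∘ a ; onNom = nm ∘ b }

    ground-valuation : Valuation canonical
    ground-valuation = record { Vprop = λ p w → True (proj₁ w) (θ p) ; Vnom = N }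

    -- DA leaves a second substitution, of `i` for `x`, outside the grounding. Merging the two gives
    -- a grounding at the updated `a`, to which the induction hypothesis applies.
    ground-binder : ∀ a x i φ →
      subst (ground a [ x ↦ sv x ]) φ [ i / x ] ≡ subst (ground (a ⟨ x ≔ i ⟩)) φ
    ground-binder a x i φ = subst-composite φ record
      { propClosed = θ-closed
      ; ownSvar    = ownSvar-update {ground a} x (λ _ ())
      ; nomClosed  = λ _ ()
      ; props      = λ p → subst-fixed (θ p) (λ _ → refl)
                       (λ y free → contradiction free (θ-closed p)) (λ _ _ → refl)
      ; svars      = ≔-elim (λ y t → substTerm (idSubst [ x ↦ nm i ]) t ≡ nm ((a ⟨ x ≔ i ⟩) y))
                       (nm ∘ a) x
                       (trans (≔-same sv x) (cong nm (sym (≔-same a x))))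
                       (λ y y≢x → cong nm (sym (≔-other a y≢x)))
      ; noms       = λ _ → refl
      }

    -- The modal cases rest on witnessing nominals, moved to the representatives of their classes.
    -- At ↓ the current point has a name, and DA at that name exchanges the binder for an instance;
    -- hence `a` varies in the induction.
    truth : ∀ φ {a g} → (∀ x → g x ≡ ⌊ a x ⌋) → ∀ w →
            Sat canonical ground-valuation g w φ ⇔ True (proj₁ w) (subst (ground a) φ)
    truth (var p)      g≡a w = ⇔-id _
    truth (tm (sv x))  g≡a w = ⌊⌋-≡ ⇔-∘ ≡-⇔ (g≡a x)
    truth (tm (nm i))  g≡a w = ⌊⌋-≡ ⇔-∘ ≡-⇔ (N≡b i)
    truth ⊥′           g≡a w = mk⇔ (λ ()) (λ d → not-both d (At.theorem (proj₁ w) (ax (taut λ _ → refl))))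
    truth ⊤′           g≡a w = mk⇔ (λ _ → At.theorem (proj₁ w) (ax (taut λ _ → refl))) (λ _ → tt)
    truth (¬′ φ)       g≡a w = true-¬ ⇔-∘ ¬-cong-⇔ (truth φ g≡a w)
    truth (φ ∨′ ψ)     g≡a w = true-∨ ⇔-∘ (truth φ g≡a w ⊎-⇔ truth ψ g≡a w)
    truth (φ ∧′ ψ)     g≡a w = true-∧ ⇔-∘ (truth φ g≡a w ×-⇔ truth ψ g≡a w)
    truth (φ ⇒ ψ)      g≡a w = true-⇒ ⇔-∘ →-cong-⇔ (truth φ g≡a w) (truth ψ g≡a w)
    truth (◇ φ)        g≡a w = mk⇔
      (λ { (v , Rwv , sat) → true-◇ Rwv (to (truth φ g≡a v) sat) })
      (λ d → let j , seesJ , φ-atJ = ◇-witness d in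
        ⌊ j ⌋ , true-◇ seesJ (rep-≈ j) ,
        from (truth φ g≡a ⌊ j ⌋) (true-transfer (rep-≈ j) φ-atJ))
    truth (□ φ) {a}    g≡a w = mk⇔
      (λ all → [ id , (λ ¬□ →
        let j , seesJ , ¬φ-atJ = ◇-witness (At.mp (proj₁ w) (At.theorem (proj₁ w) (¬□⇒◇¬ _)) ¬□) in
        contradiction (true-transfer (rep-≈ j) ¬φ-atJ)
          (not-both (to (truth φ g≡a ⌊ j ⌋) (all ⌊ j ⌋ (true-◇ seesJ (rep-≈ j)))))) ]′
        (true-or-false (proj₁ w) (□ subst (ground a) φ)))
      (λ d v Rwv → from (truth φ g≡a v) (true-□ d Rwv))
    truth (at (sv x) φ) {a} {g} g≡a w = true-at ⇔-∘ (true-rep (a x) ⇔-∘ at-value)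
      where
      at-value : Sat canonical ground-valuation g (g x) φ ⇔ True (rep (a x)) (subst (ground a) φ)
      at-value rewrite g≡a x = truth φ g≡a ⌊ a x ⌋
    truth (at (nm i) φ) {a} {g} g≡a w = true-at ⇔-∘ (true-rep (b i) ⇔-∘ at-value)
      where
      at-value : Sat canonical ground-valuation g (N i) φ ⇔ True (rep (b i)) (subst (ground a) φ)
      at-value rewrite N≡b i = truth φ g≡a ⌊ b i ⌋
    truth (↓ x φ) {a} {g} g≡a w =
      mk⇔ (At.mp i (At.∧-elimʳ i DA-x)) (At.mp i (At.∧-elimˡ i DA-x)) ⇔-∘ instance-x
      where
      i = proj₁ w
      χ = subst (ground a [ x ↦ sv x ]) φ
      DA-x : True i (↓ x χ ⇔′ χ [ i / x ])
      DA-x = thm (ax (DA i x χ))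
      instance-x : Sat canonical ground-valuation (g ⟨ x ≔ w ⟩) w φ ⇔ True i (χ [ i / x ])
      instance-x rewrite ground-binder a x i φ = truth φ
        (≔-elim (λ y v → v ≡ ⌊ (a ⟨ x ≔ i ⟩) y ⌋) g x
          (trans (sym (⌊⌋-proj₁ w)) (cong ⌊_⌋ (sym (≔-same a x))))
          (λ y y≢x → trans (g≡a y) (cong ⌊_⌋ (sym (≔-other a y≢x))))) w

    ground-safe : ∀ a φ → Safe (ground a) φ
    ground-safe a φ = closed-safe [] φ θ-closed (λ _ ()) (λ _ _ ())

-- Skeletal formulas

Holds : Sign → Set → Set
Holds + A = A
Holds - A = ¬ A

-- The direction of the implication follows the sign, so one induction proves monotonicity and
-- antitonicity together.
Along : Sign → Set → Set → Set
Along + A B = A → B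
Along - A B = B → A

along-id : ∀ s {A} → Along s A A
along-id + = id
along-id - = id

along-opposite : ∀ s {A B C D} → Along (opposite s) A B → Along s C D → Along s (A → C) (B → D)
along-opposite + f g h = g ∘ h ∘ f
along-opposite - f g h = g ∘ h ∘ f

along-⊎ : ∀ s {A B C D} → Along s A B → Along s C D → Along s (A ⊎ C) (B ⊎ D)
along-⊎ + = Sum.map
along-⊎ - = Sum.map

along-× : ∀ s {A B C D} → Along s A B → Along s C D → Along s (A × C) (B × D)
along-× + f g = Product.map f g
along-× - f g = Product.map f g

along-∃ : ∀ s {A : Set} {P B C : A → Set} → (∀ a → Along s (B a) (C a)) →
          Along s (∃[ a ] P a × B a) (∃[ a ] P a × C a)
along-∃ + f (a , Pa , Ba) = a , Pa , f a Ba
along-∃ - f (a , Pa , Ca) = a , Pa , f a Ca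

along-∀ : ∀ s {A : Set} {P B C : A → Set} → (∀ a → Along s (B a) (C a)) →
          Along s (∀ a → P a → B a) (∀ a → P a → C a)
along-∀ + f h a Pa = f a (h a Pa)
along-∀ - f h a Pa = f a (h a Pa)

along-holds : ∀ s {A B} → Along s A B → Holds s A → Holds s B
along-holds + f = f
along-holds - f = _∘ f

-- c q is the sign of the critical leaves labelled q.
module Witnesses (em : ExcludedMiddle 0ℓ) (c : PropVar → Sign) {F : Frame} (V : Valuation F) where

  Skeletal NonCritical : Node → Set
  Skeletal n = ∀ {s q} (b : Branch n s q) → c q ≡ s → SkeletalBranch b
  NonCritical n = ∀ {s q} → Branch n s q → c q ≢ s

  withProps : (PropVar → Pred (W F) 0ℓ) → Valuation F
  withProps P = record { Vprop = P ; Vnom = Vnom V }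

  -- What shrinks is the critical side: the extension for sign `+`, its complement for sign `-`.
  _≼V : (PropVar → Pred (W F) 0ℓ) → Set
  P ≼V = ∀ q v → Holds (c q) (P q v) → Holds (c q) (Vprop V q v)

  leaf-monotone : ∀ s d {A B : Set} → d ≢ s → (Holds d B → Holds d A) → Along s A B
  leaf-monotone + + d≢s f = contradiction refl d≢s
  leaf-monotone + - d≢s f = λ a → decidable-stable em λ ¬b → f ¬b a
  leaf-monotone - + d≢s f = f
  leaf-monotone - - d≢s f = contradiction refl d≢s

  -- Each leaf carries the sign opposite to the critical one, so shrinking can only help it; the
  -- connectives pass this upwards along the signs.
  monotone : ∀ {P} → P ≼V → ∀ s φ g w → NonCritical (s ∙ φ) →
             Along s (Sat F V g w φ) (Sat F (withProps P) g w φ)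
  monotone P≼V s (var q)  g w nc = leaf-monotone s (c q) (nc leaf) (P≼V q w)
  -- The value of a term ignores `Vprop`, but this computes only once the kind of term is known.
  monotone P≼V s (tm (sv x)) g w nc = along-id s
  monotone P≼V s (tm (nm i)) g w nc = along-id s
  monotone P≼V s ⊥′       g w nc = along-id s
  monotone P≼V s ⊤′       g w nc = along-id s
  monotone P≼V s (¬′ φ)   g w nc = along-opposite s
    (monotone P≼V (opposite s) φ g w λ b → nc (_ ∷⟨ ¬-child ⟩ b)) (along-id s)
  monotone P≼V s (φ ∨′ ψ) g w nc = along-⊎ s
    (monotone P≼V s φ g w λ b → nc (_ ∷⟨ ∨-left ⟩ b))
    (monotone P≼V s ψ g w λ b → nc (_ ∷⟨ ∨-right ⟩ b))
  monotone P≼V s (φ ∧′ ψ) g w nc = along-× s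
    (monotone P≼V s φ g w λ b → nc (_ ∷⟨ ∧-left ⟩ b))
    (monotone P≼V s ψ g w λ b → nc (_ ∷⟨ ∧-right ⟩ b))
  monotone P≼V s (φ ⇒ ψ)  g w nc = along-opposite s
    (monotone P≼V (opposite s) φ g w λ b → nc (_ ∷⟨ ⇒-left ⟩ b))
    (monotone P≼V s ψ g w λ b → nc (_ ∷⟨ ⇒-right ⟩ b))
  monotone P≼V s (◇ φ)    g w nc = along-∃ s
    λ v → monotone P≼V s φ g v λ b → nc (_ ∷⟨ ◇-child ⟩ b)
  monotone P≼V s (□ φ)    g w nc = along-∀ s
    λ v → monotone P≼V s φ g v λ b → nc (_ ∷⟨ □-child ⟩ b)
  monotone P≼V s (at (sv x) φ) g w nc = monotone P≼V s φ g _ λ b → nc (_ ∷⟨ at-child ⟩ b)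
  monotone P≼V s (at (nm i) φ) g w nc = monotone P≼V s φ g _ λ b → nc (_ ∷⟨ at-child ⟩ b)
  monotone P≼V s (↓ x φ)  g w nc = monotone P≼V s φ _ w λ b → nc (_ ∷⟨ ↓-child ⟩ b)

  AgreesOn : List (PropVar × W F) → (PropVar → Pred (W F) 0ℓ) → Set
  AgreesOn L P = All (λ (q , v) → Holds (c q) (P q v)) L

  -- A depends on the valuation only through finitely many critical points,
  -- apart from being preserved when the valuation shrinks below V.
  Witnessed : ((PropVar → Pred (W F) 0ℓ) → Set) → Set₁
  Witnessed A = Σ[ L ∈ List (PropVar × W F) ] AgreesOn L (Vprop V) ×
    (∀ P → AgreesOn L P → P ≼V → A P)

  witnessed-map : ∀ {A B : (PropVar → Pred (W F) 0ℓ) → Set} →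
                  (∀ {P} → A P → B P) → Witnessed A → Witnessed B
  witnessed-map f (L , agrees , A-holds) = L , agrees , λ P L≼P P≼V → f (A-holds P L≼P P≼V)

  witnessed-both : ∀ {A B : (PropVar → Pred (W F) 0ℓ) → Set} →
                   Witnessed A → Witnessed B → Witnessed (λ P → A P × B P)
  witnessed-both (L , L-agrees , A-holds) (M , M-agrees , B-holds) =
    L ++ M , ++⁺ L-agrees M-agrees , λ P L++M≼P P≼V →
      let L≼P , M≼P = ++⁻ L L++M≼P in A-holds P L≼P P≼V , B-holds P M≼P P≼V

  HoldsAt : Sign → Form → Assignment F → W F → (PropVar → Pred (W F) 0ℓ) → Set
  HoldsAt s φ g w P = Holds s (Sat F (withProps P) g w φ)

  nonCritical-witnessed : ∀ s φ g w → NonCritical (s ∙ φ) →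
                          Holds s (Sat F V g w φ) → Witnessed (HoldsAt s φ g w)
  nonCritical-witnessed s φ g w nc sat =
    [] , [] , λ P _ P≼V → along-holds s (monotone P≼V s φ g w nc) sat

  witnessed-var : ∀ s q g w → Holds s (Sat F V g w (var q)) → Witnessed (HoldsAt s (var q) g w)
  witnessed-var s q g w sat with c q Sign.≟ s
  ... | yes refl = (q , w) ∷ [] , sat ∷ [] , λ { P (Pqw ∷ []) _ → Pqw }
  ... | no  c≢s  = nonCritical-witnessed s (var q) g w (λ { leaf → c≢s }) sat

  -- Read with its sign, a skeletal node demands one child, a choice of child or successor, or both
  -- of two children, so the finite lists of the children combine. At any other node no critical
  -- branch passes, and monotonicity needs no list.
  witnessed : ∀ s φ g w → Skeletal (s ∙ φ) → Holds s (Sat F V g w φ) → Witnessed (HoldsAt s φ g w)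
  witnessed s (var q) g w sk sat = witnessed-var s q g w sat
  witnessed s (tm t) g w sk sat =
    nonCritical-witnessed s (tm t) g w (λ { (_ ∷⟨ () ⟩ _) }) sat
  witnessed s ⊥′ g w sk sat = nonCritical-witnessed s ⊥′ g w (λ { (_ ∷⟨ () ⟩ _) }) sat
  witnessed s ⊤′ g w sk sat = nonCritical-witnessed s ⊤′ g w (λ { (_ ∷⟨ () ⟩ _) }) sat
  witnessed + (¬′ φ) g w sk sat =
    witnessed - φ g w (λ b eq → proj₂ (sk (_ ∷⟨ ¬-child ⟩ b) eq)) sat
  witnessed - (¬′ φ) g w sk sat = witnessed-map (λ holds not → not holds)
    (witnessed + φ g w (λ b eq → proj₂ (sk (_ ∷⟨ ¬-child ⟩ b) eq)) (decidable-stable em sat))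
  witnessed + (φ ∨′ ψ) g w sk (inj₁ sat) = witnessed-map inj₁
    (witnessed + φ g w (λ b eq → proj₂ (sk (_ ∷⟨ ∨-left ⟩ b) eq)) sat)
  witnessed + (φ ∨′ ψ) g w sk (inj₂ sat) = witnessed-map inj₂
    (witnessed + ψ g w (λ b eq → proj₂ (sk (_ ∷⟨ ∨-right ⟩ b) eq)) sat)
  witnessed - (φ ∨′ ψ) g w sk sat = witnessed-map (λ (¬φ , ¬ψ) → [ ¬φ , ¬ψ ]′) (witnessed-both
    (witnessed - φ g w (λ b eq → proj₂ (sk (_ ∷⟨ ∨-left ⟩ b) eq)) (sat ∘ inj₁))
    (witnessed - ψ g w (λ b eq → proj₂ (sk (_ ∷⟨ ∨-right ⟩ b) eq)) (sat ∘ inj₂)))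
  witnessed + (φ ∧′ ψ) g w sk (satφ , satψ) = witnessed-both
    (witnessed + φ g w (λ b eq → proj₂ (sk (_ ∷⟨ ∧-left ⟩ b) eq)) satφ)
    (witnessed + ψ g w (λ b eq → proj₂ (sk (_ ∷⟨ ∧-right ⟩ b) eq)) satψ)
  witnessed - (φ ∧′ ψ) g w sk sat with em {Sat F V g w φ}
  ... | yes satφ = witnessed-map (_∘ proj₂)
    (witnessed - ψ g w (λ b eq → proj₂ (sk (_ ∷⟨ ∧-right ⟩ b) eq)) (λ satψ → sat (satφ , satψ)))
  ... | no ¬satφ = witnessed-map (_∘ proj₁)
    (witnessed - φ g w (λ b eq → proj₂ (sk (_ ∷⟨ ∧-left ⟩ b) eq)) ¬satφ)
  -- A critical branch from here would make this node skeletal, which it is not; hence nothing below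
  -- is critical. The same argument serves for `- ∙ (◇ φ)` and `+ ∙ (□ φ)`.
  witnessed + (φ ⇒ ψ) g w sk sat = nonCritical-witnessed + (φ ⇒ ψ) g w
    (λ { b@(_ ∷⟨ _ ⟩ _) eq → notSkeletal (proj₁ (sk b eq)) }) sat
    where
    notSkeletal : ¬ SkeletalNode (+ ∙ (φ ⇒ ψ))
    notSkeletal ()
  witnessed - (φ ⇒ ψ) g w sk sat = witnessed-map (λ (satφ , ¬ψ) φ⇒ψ → ¬ψ (φ⇒ψ satφ)) (witnessed-both
    (witnessed + φ g w (λ b eq → proj₂ (sk (_ ∷⟨ ⇒-left ⟩ b) eq))
      (decidable-stable em λ ¬satφ → sat λ satφ → contradiction satφ ¬satφ))
    (witnessed - ψ g w (λ b eq → proj₂ (sk (_ ∷⟨ ⇒-right ⟩ b) eq)) λ satψ → sat λ _ → satψ))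
  witnessed + (◇ φ) g w sk (v , Rwv , sat) = witnessed-map (λ satv → v , Rwv , satv)
    (witnessed + φ g v (λ b eq → proj₂ (sk (_ ∷⟨ ◇-child ⟩ b) eq)) sat)
  witnessed - (◇ φ) g w sk sat = nonCritical-witnessed - (◇ φ) g w
    (λ { b@(_ ∷⟨ _ ⟩ _) eq → notSkeletal (proj₁ (sk b eq)) }) sat
    where
    notSkeletal : ¬ SkeletalNode (- ∙ (◇ φ))
    notSkeletal ()
  witnessed + (□ φ) g w sk sat = nonCritical-witnessed + (□ φ) g w
    (λ { b@(_ ∷⟨ _ ⟩ _) eq → notSkeletal (proj₁ (sk b eq)) }) sat
    where
    notSkeletal : ¬ SkeletalNode (+ ∙ (□ φ))
    notSkeletal ()
  witnessed - (□ φ) g w sk sat with em {∃[ v ] R F w v × ¬ Sat F V g v φ}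
  ... | yes (v , Rwv , ¬satv) = witnessed-map (λ ¬satv all → ¬satv (all v Rwv))
    (witnessed - φ g v (λ b eq → proj₂ (sk (_ ∷⟨ □-child ⟩ b) eq)) ¬satv)
  ... | no none = contradiction
    (λ v Rwv → decidable-stable em λ ¬satv → none (v , Rwv , ¬satv)) sat
  witnessed + (at (sv x) φ) g w sk = witnessed + φ g _ λ b eq → proj₂ (sk (_ ∷⟨ at-child ⟩ b) eq)
  witnessed - (at (sv x) φ) g w sk = witnessed - φ g _ λ b eq → proj₂ (sk (_ ∷⟨ at-child ⟩ b) eq)
  witnessed + (at (nm i) φ) g w sk = witnessed + φ g _ λ b eq → proj₂ (sk (_ ∷⟨ at-child ⟩ b) eq)
  witnessed - (at (nm i) φ) g w sk = witnessed - φ g _ λ b eq → proj₂ (sk (_ ∷⟨ at-child ⟩ b) eq)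
  witnessed + (↓ x φ) g w sk = witnessed + φ _ w λ b eq → proj₂ (sk (_ ∷⟨ ↓-child ⟩ b) eq)
  witnessed - (↓ x φ) g w sk = witnessed - φ _ w λ b eq → proj₂ (sk (_ ∷⟨ ↓-child ⟩ b) eq)

module _ {n} (em : ExcludedMiddle 0ℓ) (ps : Fin n → PropVar) (ε : OrderType n) where

  -- The order-type is indexed by positions, whereas shrinking needs a sign for every variable. The
  -- value `-` outside `ps` is a default; the leaves of the formula are all labelled from `ps`.
  criticalSignOf : PropVar → Sign
  criticalSignOf q with em {Critical ps ε + q}
  ... | yes _ = +
  ... | no _  = -

  criticalSignOf-critical : ∀ {q} → ∃[ k ] ps k ≡ q → Critical ps ε (criticalSignOf q) q
  criticalSignOf-critical {q} (k , pk≡q) with em {Critical ps ε + q}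
  ... | yes critical = critical
  ... | no ¬critical with ε k in εk
  ...   | 𝟏 = contradiction (k , pk≡q , cong criticalSign εk) ¬critical
  ...   | ∂ = k , pk≡q , cong criticalSign εk

flip-child : ∀ {m s φ} → m ◁ s ∙ φ → opposite (sign m) ∙ form m ◁ opposite s ∙ φ
flip-child ¬-child  = ¬-child
flip-child ∨-left   = ∨-left
flip-child ∨-right  = ∨-right
flip-child ∧-left   = ∧-left
flip-child ∧-right  = ∧-right
flip-child ⇒-left   = ⇒-left
flip-child ⇒-right  = ⇒-right
flip-child ◇-child  = ◇-child
flip-child □-child  = □-child
flip-child at-child = at-child
flip-child ↓-child  = ↓-child

-- `VarsAmong` follows branches of the positively signed implication, where the antecedent is
-- negative and the consequent positive; the skeletal conditions use the reverse signs.
flip-branch : ∀ {m s q} → Branch m s q → Branch (opposite (sign m) ∙ form m) (opposite s) q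
flip-branch leaf = leaf
flip-branch (m ∷⟨ child ⟩ b) = _ ∷⟨ flip-child child ⟩ flip-branch b

-- Validity of skeletal theorems in the canonical frame

module _ (em : ExcludedMiddle 0ℓ) {Σ : Pred Form 0ℓ} {T : Theory} (henkin : Henkin {Σ} T) where
  open Canonical em henkin

  oneOf : List (PropVar × World) → PropVar → Form
  oneOf [] q = ⊥′
  oneOf ((p , v) ∷ L) q with p ≟ q
  ... | yes _ = tm (nm (proj₁ v)) ∨′ oneOf L q
  ... | no _  = oneOf L q

  oneOf-closed : ∀ L q {y} → ¬ FreeIn y (oneOf L q)
  oneOf-closed ((p , v) ∷ L) q with p ≟ q
  ... | yes _ = λ { (inj₂ free) → oneOf-closed L q free }
  ... | no _  = oneOf-closed L q

  oneOf-true⁺ : ∀ {L q v} → (q , v) ∈ₗ L → True (proj₁ v) (oneOf L q)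
  oneOf-true⁺ {(p , u) ∷ L} {q} {v} (here refl) with p ≟ p
  ... | yes _  = At.∨-introˡ (proj₁ v) (true-ref (proj₁ v))
  ... | no p≢p = contradiction refl p≢p
  oneOf-true⁺ {(p , u) ∷ L} {q} {v} (there ∈L) with p ≟ q
  ... | yes _ = At.∨-introʳ (proj₁ v) (oneOf-true⁺ ∈L)
  ... | no _  = oneOf-true⁺ ∈L

  oneOf-true⁻ : ∀ L {q} v → True (proj₁ v) (oneOf L q) → (q , v) ∈ₗ L
  oneOf-true⁻ [] v d = contradiction (At.theorem (proj₁ v) (ax (taut λ _ → refl))) (not-both d)
  oneOf-true⁻ ((p , u) ∷ L) {q} v d with p ≟ q
  ... | no _ = there (oneOf-true⁻ L v d)
  ... | yes refl with from true-∨ d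
  ...   | inj₂ e   = there (oneOf-true⁻ L v e)
  ...   | inj₁ v≈u = here (cong (p ,_) (sym (trans (sym (⌊⌋-proj₁ u)) (from ⌊⌋-≡ v≈u))))

  -- A negatively critical variable must be false at its listed points and is made true elsewhere,
  -- so its extension is cofinite.
  signed : Sign → Form → Form
  signed + φ = φ
  signed - φ = ¬′ φ

  signed-closed : ∀ s {φ y} → ¬ FreeIn y φ → ¬ FreeIn y (signed s φ)
  signed-closed + = id
  signed-closed - = id

  signed-true : ∀ s {i φ} → True i φ ⇔ Holds s (True i (signed s φ))
  signed-true + = mk⇔ id id
  signed-true - {i} {φ} = mk⇔ not-both λ ¬d →
    [ id , (λ d → contradiction d ¬d) ]′ (true-or-false i φ)

  -- A refutation of a skeletal formula survives shrinking the valuation to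
  -- its finitely many witnesses, which nominals define.
  skeletal-valid : ∀ {φ} → SkeletalSahlqvist φ → Σ ⊢ φ → canonical ⊩ φ
  skeletal-valid {φ ⇒ ψ} (skeletal ps _ among ε φ-skeletal ψ-skeletal) d V g w =
    decidable-stable em irrefutable
    where
    c : PropVar → Sign
    c = criticalSignOf em ps ε
    open Witnesses em c V

    antecedent : Skeletal (+ ∙ φ)
    antecedent b refl = φ-skeletal b
      (criticalSignOf-critical em ps ε (among (_ ∷⟨ ⇒-left ⟩ flip-branch b)))

    consequent : Skeletal (- ∙ ψ)
    consequent b refl = ψ-skeletal b
      (criticalSignOf-critical em ps ε (among (_ ∷⟨ ⇒-right ⟩ flip-branch b)))

    irrefutable : ¬ ¬ (Sat canonical V g w φ → Sat canonical V g w ψ)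
    irrefutable refuted = ¬satψ (sat-instance satφ)
      where
      refuting = witnessed-both
        (witnessed + φ g w antecedent
          (decidable-stable em λ ¬satφ → refuted λ satφ → contradiction satφ ¬satφ))
        (witnessed - ψ g w consequent λ satψ → refuted λ _ → satψ)
      L = proj₁ refuting

      θ : PropVar → Form
      θ q = signed (c q) (oneOf L q)
      θ-closed : ∀ q {y} → ¬ FreeIn y (θ q)
      θ-closed q = signed-closed (c q) (oneOf-closed L q)
      P : PropVar → Pred World 0ℓ
      P q v = True (proj₁ v) (θ q)

      sat-both : HoldsAt + φ g w P × HoldsAt - ψ g w P
      sat-both = proj₂ (proj₂ refuting) P
        (tabulate λ {(q , v)} ∈L → to (signed-true (c q)) (oneOf-true⁺ ∈L))
        -- A point on the critical side of `P` is one of the listed points, and there `V` has the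
        -- required value.
        (λ q v holds → lookup (proj₁ (proj₂ refuting))
          (oneOf-true⁻ L v (from (signed-true (c q)) holds)))
      satφ  = proj₁ sat-both
      ¬satψ = proj₂ sat-both

      sat-instance : Sat canonical (withProps P) g w (φ ⇒ ψ)
      sat-instance = from (truth (φ ⇒ ψ) (λ x → sym (⌊⌋-proj₁ (g x))) w)
        (thm (Nec-at (proj₁ w) (SB (ground (proj₁ ∘ g)) (ground-safe (proj₁ ∘ g) (φ ⇒ ψ)) d)))
        where open Grounding θ (proj₁ ∘ Vnom V) θ-closed (Vnom V) (λ i → sym (⌊⌋-proj₁ (Vnom V i)))

-- Strong completeness

module _ (em : ExcludedMiddle 0ℓ) {Σ : Pred Form 0ℓ} (Σ-skeletal : Σ ⊆ SkeletalSahlqvist)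
         {Γ : Pred Form 0ℓ} {γ : Form} where

  completeness : Γ ⊩[ FramesDefinedBy Σ ] γ → Γ ⊢[ Σ ] γ
  completeness Γ⊩γ = decidable-stable em λ Γ⊬γ → countermodel Γ⊬γ
    where
    module _ (Γ⊬γ : ¬ Γ ⊢[ Σ ] γ) where
      start : Stage {Σ}
      start = record
        { theory     = refutation {Σ} Γ γ
        ; consistent = refutation-consistent Γ⊬γ
        -- `fresh 0` is already taken by the refuting point.
        ; used       = 1
        ; unused     = λ
            { {m} 1≤m (refl , δ , _ , refl) (inj₁ eq) →
                contradiction (code-injective {spare} {spare} {0} {m} (nm-injective eq))
                  λ { refl → contradiction 1≤m λ () }
            ; {m} 1≤m (refl , δ , _ , refl) (inj₂ ∈δ) → fresh∉close m δ ∈δ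
            }
        }
      open Canonical em (limit-henkin em start)

      -- With `code svar` for the state variables, `ground` is `closeTerms` itself, so the truth
      -- lemma reads the hypotheses of the initial theory directly.
      open Grounding var (code nominal) (λ _ ()) (⌊_⌋ ∘ code nominal) (λ _ → refl)

      g : Assignment canonical
      g = ⌊_⌋ ∘ code svar

      sat : ∀ {δ} → δ ∈ Γ ⊎ δ ≡ ¬′ γ → Sat canonical ground-valuation g ⌊ fresh 0 ⌋ δ
      sat {δ} δ∈ = from (truth δ (λ _ → refl) ⌊ fresh 0 ⌋)
        (from (true-rep (fresh 0)) (hyp (0 , refl , δ , δ∈ , refl)))

      countermodel : ⊥
      countermodel = sat (inj₂ refl)
        (Γ⊩γ (λ σ∈Σ → skeletal-valid em (limit-henkin em start) (Σ-skeletal σ∈Σ) (extra σ∈Σ))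
          ground-valuation g ⌊ fresh 0 ⌋ (sat ∘ inj₁))

corollary7p9 : ExcludedMiddle 0ℓ →
    (Σ : Pred Form 0ℓ) → Σ ⊆ SkeletalSahlqvist →
    (Γ : Pred Form 0ℓ) (γ : Form) →
    (Γ ⊢[ Σ ] γ) ⇔ (Γ ⊩[ FramesDefinedBy Σ ] γ)
corollary7p9 em Σ Σ-skeletal Γ γ = mk⇔
  (λ (γs , γs∈Γ , d) F∈ V g w sat → soundness em d F∈ V g w (⋀-sat γs (All.map sat γs∈Γ)))
  (completeness em Σ-skeletal)
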